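{- Let $F_1$ and $F_2$ be finite subsets of $\mathbb{Z}^2$ such that $F_1$ is uniquely determined by its row and column sums and $|F_1| = |F_2|$. Let $2\alpha = \sum_{j\in\mathbb{Z}} |c_j^{(1)} - c_j^{(2)}| + \sum_{i\in\mathbb{Z}} |r_i^{(1)} - r_i^{(2)}|$, let $p = |F_1 \cap F_2|$, and write $\beta = \sqrt{\alpha}(\alpha+1)$. Then \[ |F_1| \le p + \sqrt{\frac{\alpha}{4}\left(\beta + \sqrt{\beta(\alpha-1) + 4(\alpha+1)p + \beta^2} + \frac{\alpha-1}{2}\right)^2 - \frac{(\alpha-1)^2\alpha}{16}}. \]
   Context: For $i \in \mathbb{Z}$, row $i$ is $\{(x,y)\in\mathbb{Z}^2 : x = i\}$ and for $j\in\mathbb{Z}$, column $j$ is $\{(x,y)\in\mathbb{Z}^2: y=j\}$. For $h\in\{1,2\}$, $r_i^{(h)}$ is the number of points of $F_h$ in row $i$ and $c_j^{(h)}$ the number of points of $F_h$ in column $j$. $F_1$ is uniquely determined by its row and column sums if no finite subset of $\mathbb{Z}^2$ other than $F_1$ has the same row sums and column sums. The total error in the line sums is always even, hence written $2\alpha$ with $\alpha$ a nonnegative integer. -}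

module Defs where

open import Data.Nat using (ℕ; _+_; _∸_)
open import Data.Integer as ℤ using (ℤ; +_)
open import Data.Product using (_×_; _,_; proj₁; proj₂)
open import Data.Product.Properties using (≡-dec)
open import Data.List using (List; length; filter; map; deduplicate; _++_)
open import Data.Nat.ListAction using (sum)
open import Data.List.Relation.Unary.Unique.Propositional using (Unique)
open import Data.List.Membership.Propositional using (_∈_)
open import Data.List.Membership.DecPropositional (≡-dec ℤ._≟_ ℤ._≟_) using (_∈?_)
open import Data.Rational as ℚ using (ℚ; _/_)
open import Function.Bundles using (_⇔_)
open import Relation.Binary.PropositionalEquality using (_≡_)

-- Points of ℤ²; a point (x , y) lies in row x and column y.
Point : Set
Point = ℤ × ℤ

record FinSet : Set where
  constructor finset
  field
    elems   : List Point
    nodup   : Unique elems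
open FinSet public

card : FinSet → ℕ
card F = length (elems F)

rowSum : FinSet → ℤ → ℕ
rowSum F i = length (filter (λ q → proj₁ q ℤ.≟ i) (elems F))

colSum : FinSet → ℤ → ℕ
colSum F j = length (filter (λ q → proj₂ q ℤ.≟ j) (elems F))

interCard : FinSet → FinSet → ℕ
interCard F G = length (filter (λ q → q ∈? elems G) (elems F))

UniquelyDetermined : FinSet → Set
UniquelyDetermined F =
  (G : FinSet) →
  (∀ i → rowSum G i ≡ rowSum F i) →
  (∀ j → colSum G j ≡ colSum F j) →
  ∀ q → (q ∈ elems G) ⇔ (q ∈ elems F)

absDiff : ℕ → ℕ → ℕ
absDiff a b = (a ∸ b) + (b ∸ a)

-- Σ_{j ∈ ℤ} |c_j^(1) - c_j^(2)| + Σ_{i ∈ ℤ} |r_i^(1) - r_i^(2)|.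
-- The summands vanish outside the (finite) sets of rows/columns met by F₁ ∪ F₂,
-- so each sum over ℤ is computed over those (deduplicated) indices.
usedRows : FinSet → FinSet → List ℤ
usedRows F G = deduplicate ℤ._≟_ (map proj₁ (elems F ++ elems G))

usedCols : FinSet → FinSet → List ℤ
usedCols F G = deduplicate ℤ._≟_ (map proj₂ (elems F ++ elems G))

totalError : FinSet → FinSet → ℕ
totalError F G =
  sum (map (λ j → absDiff (colSum F j) (colSum G j)) (usedCols F G)) +
  sum (map (λ i → absDiff (rowSum F i) (rowSum G i)) (usedRows F G))

ℕtoℚ : ℕ → ℚ
ℕtoℚ n = (+ n) / 1

-- Real-number bound encoded via rational upper approximations of the radicals.
-- With β(s) = s (α+1),
--   I(s)   = β(s)(α-1) + 4(α+1)p + β(s)²,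
--   X(s,t) = (α/4)(β(s) + t + (α-1)/2)² - (α-1)²α/16,
-- the real bound d ≤ √X(√α, √I(√α)) is expressed as:
-- for all rationals s,t,u ≥ 0 with s² ≥ α, t² ≥ I(s), u² ≥ X(s,t), we have d ≤ u.
module _ (α p : ℕ) where
  private
    a = ℕtoℚ α
    P = ℕtoℚ p
  βq : ℚ → ℚ
  βq s = s ℚ.* (a ℚ.+ ℚ.1ℚ)

  Iq : ℚ → ℚ
  Iq s = βq s ℚ.* (a ℚ.- ℚ.1ℚ) ℚ.+ ℕtoℚ 4 ℚ.* (a ℚ.+ ℚ.1ℚ) ℚ.* P ℚ.+ βq s ℚ.* βq s

  Xq : ℚ → ℚ → ℚ
  Xq s t = (a ℚ.* ((+ 1) / 4)) ℚ.* (b ℚ.* b)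
           ℚ.- (a ℚ.- ℚ.1ℚ) ℚ.* (a ℚ.- ℚ.1ℚ) ℚ.* a ℚ.* ((+ 1) / 16)
    where b = βq s ℚ.+ t ℚ.+ (a ℚ.- ℚ.1ℚ) ℚ.* ((+ 1) / 2)

  BoundHolds : ℚ → Set
  BoundHolds d = ∀ (s t u : ℚ) → ℚ.0ℚ ℚ.≤ s → ℚ.0ℚ ℚ.≤ t → ℚ.0ℚ ℚ.≤ u →
    a ℚ.≤ s ℚ.* s → Iq s ℚ.≤ t ℚ.* t → Xq s t ℚ.≤ u ℚ.* u → d ℚ.≤ u

{-# OPTIONS --safe #-}

-- Write D = F₁ \ F₂ and d = |D| = |F₁| − p. Unique determination means that F₁ has no switching
-- component, i.e. F₁ is a Young diagram up to permuting rows and columns. If R × Q ⊆ F₁ and F₁ misses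
-- Rᶜ × Qᶜ, comparing the line sums over R and over Qᶜ gives |D ∩ (R × Q)| ≤ α. Apply this to the n
-- maximal rectangles of the diagram: a point of D lies in at least two of them unless it lies in a
-- corner block w_k × h_k, so 2d ≤ αn + Σ min(α, w_k h_k). On the other hand |F₁| = Σ_{i≤j} w_i h_j
-- grows quadratically in n and in the excesses w_k − 1, h_k − 1, and Cauchy–Schwarz then yields
-- d² ≤ α(α+1)|F₁| = α(α+1)(p+d). This quadratic inequality for d implies the stated bound.
module Submission where

open import Defs
open import Level using (0ℓ)
open import Data.Bool using (Bool; true; false; _∧_; not)
import Data.Bool.Properties as Bool
open import Data.Empty using (⊥; ⊥-elim)
open import Data.Integer as ℤ using (ℤ)
import Data.Integer.Properties as ℤ
open import Data.List using (List; []; _∷_; _++_; map; length; filter)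
open import Data.List.Properties using (map-++)
open import Data.List.Membership.Propositional using (_∈_; _∉_; find)
open import Data.List.Membership.Propositional.Properties
  using (∈-filter⁺; ∈-filter⁻; ∈-++⁻; ∈-∃++; ∈-map⁺; ∈-++⁺ˡ; ∈-++⁺ʳ; ∈-deduplicate⁺)
open import Data.List.Membership.DecPropositional using (_∈?_)
open import Data.List.Relation.Unary.All as All using (All; _∷_; all?)
open import Data.List.Relation.Unary.All.Properties using (¬All⇒Any¬; ¬Any⇒All¬)
open import Data.List.Relation.Unary.AllPairs using (_∷_)
open import Data.List.Relation.Unary.Any using (here; there)
open import Data.List.Relation.Unary.Unique.Propositional using (Unique)
open import Data.List.Relation.Unary.Unique.DecPropositional.Properties using (deduplicate-!)
open import Data.List.Relation.Binary.Permutation.Propositional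
  using (_↭_; ↭-sym; ↭-trans; prep; ↭⇒↭ₛ)
open import Data.List.Relation.Binary.Permutation.Propositional.Properties using (shift; ∈-resp-↭; map⁺)
import Data.List.Relation.Binary.Permutation.Setoid.Properties as Permₛ
open import Data.Nat using (ℕ; zero; suc; _+_; _*_; _∸_; _⊓_; _≤_; z≤n; s≤s)
open import Data.Nat.ListAction using (sum)
open import Data.Nat.ListAction.Properties using (sum-++; sum-↭)
open import Data.Nat.Properties
open import Data.Nat.Tactic.RingSolver using (solve-∀)
open import Data.Product using (_×_; _,_; ∃-syntax; proj₁; proj₂)
open import Data.Product.Properties using (≡-dec)
open import Data.Rational as ℚ using (ℚ; 0ℚ; 1ℚ; _/_; nonNegative; positive; toℚᵘ)
import Data.Rational.Properties as ℚ
open import Data.Rational.Solver using (module +-*-Solver)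
import Data.Rational.Unnormalised as ℚᵘ
import Data.Rational.Unnormalised.Properties as ℚᵘ
open import Data.Sum using (inj₁; inj₂)
open import Function using (_∘_)
open import Function.Bundles using (module Equivalence; mk⇔)
open import Relation.Binary.PropositionalEquality
open import Relation.Nullary using (¬_; Dec; does; yes; no; ¬?)
open import Relation.Nullary.Decidable using (dec-true; dec-false; does-⇔; _×-dec_)
open import Relation.Unary using (Pred; Decidable)

-- The bound with radicals from a quadratic inequality

x≤y⇒0≤y-x : ∀ {x y} → x ℚ.≤ y → 0ℚ ℚ.≤ y ℚ.- x
x≤y⇒0≤y-x {x} {y} x≤y = subst (ℚ._≤ y ℚ.- x) (ℚ.+-inverseʳ x) (ℚ.+-monoˡ-≤ (ℚ.- x) x≤y)

x<y⇒0<y-x : ∀ {x y} → x ℚ.< y → 0ℚ ℚ.< y ℚ.- x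
x<y⇒0<y-x {x} {y} x<y = subst (ℚ._< y ℚ.- x) (ℚ.+-inverseʳ x) (ℚ.+-monoˡ-< (ℚ.- x) x<y)

<⇒≱ℚ : ∀ {x y} → x ℚ.< y → ¬ (y ℚ.≤ x)
<⇒≱ℚ x<y y≤x = ℚ.<-irrefl refl (ℚ.<-≤-trans x<y y≤x)

0≤x+y : ∀ {x y} → 0ℚ ℚ.≤ x → 0ℚ ℚ.≤ y → 0ℚ ℚ.≤ x ℚ.+ y
0≤x+y = ℚ.+-mono-≤

0≤x*y : ∀ {x y} → 0ℚ ℚ.≤ x → 0ℚ ℚ.≤ y → 0ℚ ℚ.≤ x ℚ.* y
0≤x*y {x} {y} 0≤x 0≤y =
  ℚ.nonNegative⁻¹ _ {{ℚ.nonNeg*nonNeg⇒nonNeg x {{nonNegative 0≤x}} y {{nonNegative 0≤y}}}}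

0<x*y : ∀ {x y} → 0ℚ ℚ.< x → 0ℚ ℚ.< y → 0ℚ ℚ.< x ℚ.* y
0<x*y {x} {y} 0<x 0<y =
  ℚ.positive⁻¹ _ {{ℚ.pos*pos⇒pos x {{positive 0<x}} y {{positive 0<y}}}}

4ℚ : ℚ
4ℚ = ℕtoℚ 4

0≤4 : 0ℚ ℚ.≤ 4ℚ
0≤4 = ℚ.nonNegative⁻¹ 4ℚ

0≤2 : 0ℚ ℚ.≤ ℕtoℚ 2
0≤2 = ℚ.nonNegative⁻¹ (ℕtoℚ 2)

module _ (α p : ℕ) where
  private
    a = ℕtoℚ α
    P = ℕtoℚ p
    2ℚ = ℕtoℚ 2

  β+t : ℚ → ℚ → ℚ
  β+t s t = βq α p s ℚ.+ t

  -- Here 4 X = a z (z + a − 1), which is why β and t enter only through z = β + t.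
  4[u²-d²]-expansion : ∀ s t u d → 4ℚ ℚ.* (u ℚ.* u ℚ.- d ℚ.* d) ≡
    4ℚ ℚ.* (u ℚ.* u ℚ.- Xq α p s t)
    ℚ.+ (a ℚ.* β+t s t ℚ.* (a ℚ.- 1ℚ)
    ℚ.+ (a ℚ.* (t ℚ.* t ℚ.- Iq α p s)
    ℚ.+ (a ℚ.* βq α p s ℚ.* (a ℚ.- 1ℚ)
    ℚ.+ (2ℚ ℚ.* (a ℚ.* (a ℚ.+ 1ℚ)) ℚ.* (s ℚ.* β+t s t ℚ.- 2ℚ ℚ.* d)
    ℚ.+ 4ℚ ℚ.* (a ℚ.* (a ℚ.+ 1ℚ) ℚ.* (P ℚ.+ d) ℚ.- d ℚ.* d)))))
  4[u²-d²]-expansion s t u d = solve 6 (λ a P s t u d →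
    let one = con 1ℚ ; four = con 4ℚ ; two = con 2ℚ
        β = s :* (a :+ one)
        I = β :* (a :- one) :+ four :* (a :+ one) :* P :+ β :* β
        b = β :+ t :+ (a :- one) :* con ((ℤ.+ 1) / 2)
        X = (a :* con ((ℤ.+ 1) / 4)) :* (b :* b) :- (a :- one) :* (a :- one) :* a :* con ((ℤ.+ 1) / 16)
        z = β :+ t
    in four :* (u :* u :- d :* d) :=
       four :* (u :* u :- X)
       :+ (a :* z :* (a :- one)
       :+ (a :* (t :* t :- I)
       :+ (a :* β :* (a :- one)
       :+ (two :* (a :* (a :+ one)) :* (s :* z :- two :* d)
       :+ four :* (a :* (a :+ one) :* (P :+ d) :- d :* d))))))
    refl a P s t u d
    where open +-*-Solver

  -- With f(x) = x² − 2a(a+1)x, the left side is f(2d) − f(sz); its second factor is 2d + sz − 2a(a+1).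
  [2d-sz]-factorisation : ∀ s t d →
    (2ℚ ℚ.* d ℚ.- s ℚ.* β+t s t) ℚ.*
    ((2ℚ ℚ.* d ℚ.- s ℚ.* β+t s t) ℚ.+ 2ℚ ℚ.* ((s ℚ.* s ℚ.- a) ℚ.* (a ℚ.+ 1ℚ) ℚ.+ s ℚ.* t))
    ≡ ℚ.- ((s ℚ.* s ℚ.- a) ℚ.* (β+t s t ℚ.* β+t s t)
    ℚ.+ (a ℚ.* (t ℚ.* t ℚ.- Iq α p s)
    ℚ.+ (a ℚ.* βq α p s ℚ.* (a ℚ.- 1ℚ)
    ℚ.+ 4ℚ ℚ.* (a ℚ.* (a ℚ.+ 1ℚ) ℚ.* (P ℚ.+ d) ℚ.- d ℚ.* d))))
  [2d-sz]-factorisation s t d = solve 5 (λ a P s t d →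
    let one = con 1ℚ ; four = con 4ℚ ; two = con 2ℚ
        β = s :* (a :+ one)
        I = β :* (a :- one) :+ four :* (a :+ one) :* P :+ β :* β
        z = β :+ t
    in (two :* d :- s :* z) :* ((two :* d :- s :* z) :+ two :* ((s :* s :- a) :* (a :+ one) :+ s :* t))
       := :- ((s :* s :- a) :* (z :* z)
       :+ (a :* (t :* t :- I)
       :+ (a :* β :* (a :- one)
       :+ four :* (a :* (a :+ one) :* (P :+ d) :- d :* d)))))
    refl a P s t d
    where open +-*-Solver

  module _ (d s t u : ℚ) (1≤a : 1ℚ ℚ.≤ a)
    (d²≤ : d ℚ.* d ℚ.≤ a ℚ.* (a ℚ.+ 1ℚ) ℚ.* (P ℚ.+ d))
    (0≤s : 0ℚ ℚ.≤ s) (0≤t : 0ℚ ℚ.≤ t) (0≤u : 0ℚ ℚ.≤ u)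
    (a≤s² : a ℚ.≤ s ℚ.* s) (I≤t² : Iq α p s ℚ.≤ t ℚ.* t) (X≤u² : Xq α p s t ℚ.≤ u ℚ.* u)
    where
    private
      0≤a : 0ℚ ℚ.≤ a
      0≤a = ℚ.≤-trans (ℚ.nonNegative⁻¹ 1ℚ) 1≤a
      0≤a+1 : 0ℚ ℚ.≤ a ℚ.+ 1ℚ
      0≤a+1 = 0≤x+y 0≤a (ℚ.nonNegative⁻¹ 1ℚ)
      0≤β : 0ℚ ℚ.≤ βq α p s
      0≤β = 0≤x*y 0≤s 0≤a+1
      0≤z : 0ℚ ℚ.≤ β+t s t
      0≤z = 0≤x+y 0≤β 0≤t
      0≤a-1 : 0ℚ ℚ.≤ a ℚ.- 1ℚ
      0≤a-1 = x≤y⇒0≤y-x 1≤a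
      0≤aβ[a-1] : 0ℚ ℚ.≤ a ℚ.* βq α p s ℚ.* (a ℚ.- 1ℚ)
      0≤aβ[a-1] = 0≤x*y (0≤x*y 0≤a 0≤β) 0≤a-1

    -- Every summand of `4[u²-d²]-expansion` is nonnegative: the three approximation hypotheses,
    -- `d²≤` and `2d≤sz` each account for one, and `1≤a` for the rest.
    2d≤sz⇒d²≤u² : 2ℚ ℚ.* d ℚ.≤ s ℚ.* β+t s t → 0ℚ ℚ.≤ 4ℚ ℚ.* (u ℚ.* u ℚ.- d ℚ.* d)
    2d≤sz⇒d²≤u² 2d≤sz = subst (0ℚ ℚ.≤_) (sym (4[u²-d²]-expansion s t u d))
      (0≤x+y (0≤x*y 0≤4 (x≤y⇒0≤y-x X≤u²))
      (0≤x+y (0≤x*y (0≤x*y 0≤a 0≤z) 0≤a-1)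
      (0≤x+y (0≤x*y 0≤a (x≤y⇒0≤y-x I≤t²))
      (0≤x+y 0≤aβ[a-1]
      (0≤x+y (0≤x*y (0≤x*y 0≤2 (0≤x*y 0≤a 0≤a+1)) (x≤y⇒0≤y-x 2d≤sz))
      (0≤x*y 0≤4 (x≤y⇒0≤y-x d²≤)))))))

    -- Otherwise both factors on the left of `[2d-sz]-factorisation` are positive, while the right
    -- side is minus a sum of nonnegative terms.
    2d≯sz : ¬ (s ℚ.* β+t s t ℚ.< 2ℚ ℚ.* d)
    2d≯sz sz<2d = <⇒≱ℚ
      (subst (0ℚ ℚ.<_) ([2d-sz]-factorisation s t d)
        (0<x*y (x<y⇒0<y-x sz<2d) (ℚ.+-mono-<-≤ (x<y⇒0<y-x sz<2d)
          (0≤x*y 0≤2 (0≤x+y (0≤x*y (x≤y⇒0≤y-x a≤s²) 0≤a+1) (0≤x*y 0≤s 0≤t))))))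
      (ℚ.neg-antimono-≤
        (0≤x+y (0≤x*y (x≤y⇒0≤y-x a≤s²) (0≤x*y 0≤z 0≤z))
        (0≤x+y (0≤x*y 0≤a (x≤y⇒0≤y-x I≤t²))
        (0≤x+y 0≤aβ[a-1]
        (0≤x*y 0≤4 (x≤y⇒0≤y-x d²≤))))))

    d≤u : d ℚ.≤ u
    d≤u = ℚ.≮⇒≥ λ u<d → <⇒≱ℚ
      (subst (ℚ._< 0ℚ) (sym difference-of-squares)
        (ℚ.neg-antimono-< (0<x*y (ℚ.positive⁻¹ 4ℚ)
          (0<x*y (x<y⇒0<y-x u<d) (ℚ.+-mono-<-≤ (ℚ.≤-<-trans 0≤u u<d) 0≤u)))))
      (2d≤sz⇒d²≤u² (ℚ.≮⇒≥ 2d≯sz))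
      where
      difference-of-squares : 4ℚ ℚ.* (u ℚ.* u ℚ.- d ℚ.* d) ≡ ℚ.- (4ℚ ℚ.* ((d ℚ.- u) ℚ.* (d ℚ.+ u)))
      difference-of-squares = solve 2
        (λ u d → con 4ℚ :* (u :* u :- d :* d) := :- (con 4ℚ :* ((d :- u) :* (d :+ u))))
        refl u d
        where open +-*-Solver

-- Natural numbers inside the rationals

toℚᵘ-ℕtoℚ : ∀ n → toℚᵘ (ℕtoℚ n) ℚᵘ.≃ ℚᵘ.mkℚᵘ (ℤ.+ n) 0
toℚᵘ-ℕtoℚ n = ℚ.toℚᵘ-fromℚᵘ (ℚᵘ.mkℚᵘ (ℤ.+ n) 0)

ℕtoℚ-+ : ∀ m n → ℕtoℚ (m + n) ≡ ℕtoℚ m ℚ.+ ℕtoℚ n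
ℕtoℚ-+ m n = ℚ.toℚᵘ-injective (begin
  toℚᵘ (ℕtoℚ (m + n))                  ≈⟨ toℚᵘ-ℕtoℚ (m + n) ⟩
  ℚᵘ.mkℚᵘ (ℤ.+ (m + n)) 0                ≈⟨ ℚᵘ.*≡* (cong (ℤ._* ℤ.+ 1) (cong₂ ℤ._+_
                                               (sym (ℤ.*-identityʳ (ℤ.+ m))) (sym (ℤ.*-identityʳ (ℤ.+ n))))) ⟩
  ℚᵘ.mkℚᵘ (ℤ.+ m) 0 ℚᵘ.+ ℚᵘ.mkℚᵘ (ℤ.+ n) 0   ≈⟨ ℚᵘ.+-cong (toℚᵘ-ℕtoℚ m) (toℚᵘ-ℕtoℚ n) ⟨
  toℚᵘ (ℕtoℚ m) ℚᵘ.+ toℚᵘ (ℕtoℚ n)       ≈⟨ ℚ.toℚᵘ-homo-+ (ℕtoℚ m) (ℕtoℚ n) ⟨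
  toℚᵘ (ℕtoℚ m ℚ.+ ℕtoℚ n)               ∎)
  where open ℚᵘ.≃-Reasoning

ℕtoℚ-* : ∀ m n → ℕtoℚ (m * n) ≡ ℕtoℚ m ℚ.* ℕtoℚ n
ℕtoℚ-* m n = ℚ.toℚᵘ-injective (begin
  toℚᵘ (ℕtoℚ (m * n))                  ≈⟨ toℚᵘ-ℕtoℚ (m * n) ⟩
  ℚᵘ.mkℚᵘ (ℤ.+ (m * n)) 0                ≈⟨ ℚᵘ.*≡* (cong (ℤ._* ℤ.+ 1) (ℤ.pos-* m n)) ⟩
  ℚᵘ.mkℚᵘ (ℤ.+ m) 0 ℚᵘ.* ℚᵘ.mkℚᵘ (ℤ.+ n) 0   ≈⟨ ℚᵘ.*-cong (toℚᵘ-ℕtoℚ m) (toℚᵘ-ℕtoℚ n) ⟨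
  toℚᵘ (ℕtoℚ m) ℚᵘ.* toℚᵘ (ℕtoℚ n)       ≈⟨ ℚ.toℚᵘ-homo-* (ℕtoℚ m) (ℕtoℚ n) ⟨
  toℚᵘ (ℕtoℚ m ℚ.* ℕtoℚ n)               ∎)
  where open ℚᵘ.≃-Reasoning

ℕtoℚ-mono-≤ : ∀ {m n} → m ≤ n → ℕtoℚ m ℚ.≤ ℕtoℚ n
ℕtoℚ-mono-≤ {m} {n} m≤n = ℚ.toℚᵘ-cancel-≤ (begin
  toℚᵘ (ℕtoℚ m)     ≃⟨ toℚᵘ-ℕtoℚ m ⟩
  ℚᵘ.mkℚᵘ (ℤ.+ m) 0   ≤⟨ ℚᵘ.*≤* (ℤ.*-monoʳ-≤-nonNeg (ℤ.+ 1) (ℤ.+≤+ m≤n)) ⟩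
  ℚᵘ.mkℚᵘ (ℤ.+ n) 0   ≃⟨ toℚᵘ-ℕtoℚ n ⟨
  toℚᵘ (ℕtoℚ n)     ∎)
  where open ℚᵘ.≤-Reasoning

-- The argument with radicals relies on `a - 1` being nonnegative, so α = 0 is treated apart: there
-- the hypothesis reads d² ≤ 0, and for d = 0 the claim is 0 ≤ u.
d²≤α[α+1][p+d]⇒BoundHolds : ∀ α p d → d * d ≤ α * (α + 1) * (p + d) →
  BoundHolds α p (ℕtoℚ d)
d²≤α[α+1][p+d]⇒BoundHolds zero p zero d²≤ s t u 0≤s 0≤t 0≤u a≤s² I≤t² X≤u² = 0≤u
d²≤α[α+1][p+d]⇒BoundHolds zero p (suc d) ()
d²≤α[α+1][p+d]⇒BoundHolds α@(suc _) p d d²≤ s t u =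
  d≤u α p (ℕtoℚ d) s t u (ℕtoℚ-mono-≤ {1} {α} (s≤s z≤n))
    (subst₂ ℚ._≤_ (ℕtoℚ-* d d) rhs (ℕtoℚ-mono-≤ d²≤))
  where
  rhs : ℕtoℚ (α * (α + 1) * (p + d)) ≡
        ℕtoℚ α ℚ.* (ℕtoℚ α ℚ.+ 1ℚ) ℚ.* (ℕtoℚ p ℚ.+ ℕtoℚ d)
  rhs = trans (ℕtoℚ-* (α * (α + 1)) (p + d)) (cong₂ ℚ._*_
    (trans (ℕtoℚ-* α (α + 1)) (cong (ℕtoℚ α ℚ.*_) (ℕtoℚ-+ α 1)))
    (ℕtoℚ-+ p d))

ℕtoℚ-∸ : ∀ m n → ℕtoℚ (m + n) ℚ.- ℕtoℚ m ≡ ℕtoℚ n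
ℕtoℚ-∸ m n = trans (cong (ℚ._- ℕtoℚ m) (ℕtoℚ-+ m n))
  (solve 2 (λ x y → x :+ y :- x := y) refl (ℕtoℚ m) (ℕtoℚ n))
  where open +-*-Solver

-- Numerical estimates for corner blocks

module _ where
  open ≤-Reasoning

  -- Subtraction is avoided by writing the larger number as the smaller plus k; the two sides then
  -- differ by k².
  2mn≤m²+n² : ∀ m n → 2 * (m * n) ≤ m * m + n * n
  2mn≤m²+n² m n with ≤-total m n
  ... | inj₁ m≤n with _ , refl ← m≤n⇒∃[o]m+o≡n m≤n = lemma m _
    where
    identity : ∀ m k → m * m + (m + k) * (m + k) ≡ 2 * (m * (m + k)) + k * k
    identity = solve-∀
    lemma : ∀ m k → 2 * (m * (m + k)) ≤ m * m + (m + k) * (m + k)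
    lemma m k = subst (2 * (m * (m + k)) ≤_) (sym (identity m k)) (m≤m+n _ _)
  ... | inj₂ n≤m with _ , refl ← m≤n⇒∃[o]m+o≡n n≤m = lemma n _
    where
    identity : ∀ n k → (n + k) * (n + k) + n * n ≡ 2 * ((n + k) * n) + k * k
    identity = solve-∀
    lemma : ∀ n k → 2 * ((n + k) * n) ≤ (n + k) * (n + k) + n * n
    lemma n k = subst (2 * ((n + k) * n) ≤_) (sym (identity n k)) (m≤m+n _ _)

  -- One more corner: its full columns add a strip of area `suc w * (suc h + ρ)`, where ρ counts the
  -- rows left after it. Since the capped excesses a and b are at most c, the new squares are at
  -- most ca and cb, and the cross terms 2aA and 2bB at most 2acn and 2cB. All of this fits into the
  -- strip computed with a, b and n + B in place of w, h and ρ; the term added in the middle is the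
  -- slack.
  area-step : ∀ c n A B S ρ h w → A ≤ c * n → n + B ≤ ρ →
    c * (n * n) + (A * A + B * B) ≤ 2 * (c * S) →
    c * (suc n * suc n) + ((c ⊓ w + A) * (c ⊓ w + A) + (c ⊓ h + B) * (c ⊓ h + B))
      ≤ 2 * (c * (suc w * (suc h + ρ) + S))
  area-step c n A B S ρ h w A≤cn n+B≤ρ IH = begin
    c * (suc n * suc n) + ((a + A) * (a + A) + (b + B) * (b + B))
      ≡⟨ expand c n A B a b ⟩
    (a * a + 2 * (a * A) + (b * b + 2 * (b * B))) + c * (2 * n + 1) + (c * (n * n) + (A * A + B * B))
      ≤⟨ +-mono-≤ (+-monoˡ-≤ (c * (2 * n + 1)) (+-mono-≤
           (+-mono-≤ (*-monoˡ-≤ a a≤c) (*-monoʳ-≤ 2 (*-monoʳ-≤ a A≤cn)))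
           (+-mono-≤ (*-monoˡ-≤ b b≤c) (*-monoʳ-≤ 2 (*-monoˡ-≤ B b≤c))))) IH ⟩
    (c * a + 2 * (a * (c * n)) + (c * b + 2 * (c * B))) + c * (2 * n + 1) + 2 * (c * S)
      ≤⟨ m≤m+n _ (c + c * a + c * b + 2 * (c * (a * (b + B)))) ⟩
    (c * a + 2 * (a * (c * n)) + (c * b + 2 * (c * B))) + c * (2 * n + 1) + 2 * (c * S)
      + (c + c * a + c * b + 2 * (c * (a * (b + B))))
      ≡⟨ collect c n B a b S ⟩
    2 * (c * (suc a * (suc b + (n + B)) + S))
      ≤⟨ *-monoʳ-≤ 2 (*-monoʳ-≤ c (+-monoˡ-≤ S
           (*-mono-≤ (s≤s (m⊓n≤n c w)) (+-mono-≤ (s≤s (m⊓n≤n c h)) n+B≤ρ)))) ⟩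
    2 * (c * (suc w * (suc h + ρ) + S)) ∎
    where
    a = c ⊓ w
    b = c ⊓ h
    a≤c = m⊓n≤m c w
    b≤c = m⊓n≤m c h
    expand : ∀ c n A B a b → c * (suc n * suc n) + ((a + A) * (a + A) + (b + B) * (b + B)) ≡
      (a * a + 2 * (a * A) + (b * b + 2 * (b * B))) + c * (2 * n + 1) + (c * (n * n) + (A * A + B * B))
    expand = solve-∀
    collect : ∀ c n B a b S → (c * a + 2 * (a * (c * n)) + (c * b + 2 * (c * B))) + c * (2 * n + 1) + 2 * (c * S)
      + (c + c * a + c * b + 2 * (c * (a * (b + B)))) ≡ 2 * (c * (suc a * (suc b + (n + B)) + S))
    collect = solve-∀

  -- e, suc w and suc h stand for the number of points of F₁ \ F₂ in the corner block and its dimensions.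
  -- Capping w and h at c keeps the quadratic estimate area-step valid; the final constant α(α+1) is
  -- reached with c = 1 for α ≤ 2 and with c = 2 for α ≥ 3.
  BlockBound : (c α k l : ℕ) → Set
  BlockBound c α k l = ∀ e w h → e ≤ α → e ≤ suc w * suc h → c * e ≤ k + l * (c ⊓ w + c ⊓ h)

  -- Settles every block whose capped excess `t` is at least c: there the bound of e by the error
  -- `suc α` suffices, whatever the area of the block.
  c*e≤c+α*t : ∀ c α e t → c ≤ t → e ≤ suc α → c * e ≤ c + α * t
  c*e≤c+α*t c α e t c≤t e≤1+α = begin
    c * e          ≤⟨ *-monoʳ-≤ c e≤1+α ⟩
    c * suc α      ≡⟨ *-suc c α ⟩
    c + c * α      ≡⟨ cong (c +_) (*-comm c α) ⟩
    c + α * c      ≤⟨ +-monoʳ-≤ c (*-monoʳ-≤ α c≤t) ⟩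
    c + α * t      ∎

  blockBound₀ : BlockBound 1 0 0 0
  blockBound₀ zero w h z≤n _ = z≤n

  blockBound₁ : ∀ α → BlockBound 1 (1 + α) 1 α
  blockBound₁ α e zero    zero    e≤α e≤wh = ≤-trans (*-monoʳ-≤ 1 e≤wh) (m≤m+n 1 _)
  blockBound₁ α e zero    (suc h) e≤α e≤wh = c*e≤c+α*t 1 α e 1 (s≤s z≤n) e≤α
  blockBound₁ α e (suc w) h       e≤α e≤wh = c*e≤c+α*t 1 α e (1 + 1 ⊓ h) (s≤s z≤n) e≤α

  -- Only blocks of size 1 × 1, 1 × 2 and 2 × 1 have capped excess below 2, and for them the area
  -- bounds e. A block of area 2 calls for 4 ≤ 2 + l, which is why this version starts at error 3,
  -- where l = 2.
  blockBound₂ : ∀ α → BlockBound 2 (3 + α) 2 (2 + α)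
  blockBound₂ α e zero          zero          e≤α e≤wh = ≤-trans (*-monoʳ-≤ 2 e≤wh) (s≤s (s≤s z≤n))
  blockBound₂ α e zero          (suc zero)    e≤α e≤wh = ≤-trans (*-monoʳ-≤ 2 e≤wh) (s≤s (s≤s (s≤s (s≤s z≤n))))
  blockBound₂ α e (suc zero)    zero          e≤α e≤wh = ≤-trans (*-monoʳ-≤ 2 e≤wh) (s≤s (s≤s (s≤s (s≤s z≤n))))
  blockBound₂ α e zero          (suc (suc h)) e≤α e≤wh = c*e≤c+α*t 2 (2 + α) e 2 (s≤s (s≤s z≤n)) e≤α
  blockBound₂ α e (suc zero)    (suc h)       e≤α e≤wh = c*e≤c+α*t 2 (2 + α) e (1 + 2 ⊓ suc h) (s≤s (s≤s z≤n)) e≤α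
  blockBound₂ α e (suc (suc w)) h             e≤α e≤wh = c*e≤c+α*t 2 (2 + α) e (2 + 2 ⊓ h) (s≤s (s≤s z≤n)) e≤α

  [A+B]²≤2[A²+B²] : ∀ A B → (A + B) * (A + B) ≤ 2 * (A * A + B * B)
  [A+B]²≤2[A²+B²] A B = begin
    (A + B) * (A + B)                   ≡⟨ e₁ A B ⟩
    A * A + B * B + 2 * (A * B)         ≤⟨ +-monoʳ-≤ (A * A + B * B) (2mn≤m²+n² A B) ⟩
    A * A + B * B + (A * A + B * B)     ≡⟨ e₂ (A * A + B * B) ⟩
    2 * (A * A + B * B)                 ∎
    where
    e₁ : ∀ A B → (A + B) * (A + B) ≡ A * A + B * B + 2 * (A * B)
    e₁ = solve-∀
    e₂ : ∀ x → x + x ≡ 2 * x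
    e₂ = solve-∀

  -- The count of points involves A and B only through A + B, so the area estimate is brought to the
  -- same form.
  area-sum : ∀ c n A B S → c * (n * n) + (A * A + B * B) ≤ 2 * (c * S) →
    2 * (c * (n * n)) + (A + B) * (A + B) ≤ 4 * (c * S)
  area-sum c n A B S h = begin
    2 * (c * (n * n)) + (A + B) * (A + B)           ≤⟨ +-monoʳ-≤ (2 * (c * (n * n))) ([A+B]²≤2[A²+B²] A B) ⟩
    2 * (c * (n * n)) + 2 * (A * A + B * B)         ≡⟨ *-distribˡ-+ 2 (c * (n * n)) _ ⟨
    2 * (c * (n * n) + (A * A + B * B))             ≤⟨ *-monoʳ-≤ 2 h ⟩
    2 * (2 * (c * S))                               ≡⟨ *-assoc 2 2 (c * S) ⟨
    4 * (c * S)                                     ∎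

  -- Quadratic bounds for d, according to the size of the error

  d²-bound₀ : ∀ d S A B n → 2 * (1 * d) ≤ (1 * 0 + 0) * n + 0 * (A + B) → d * d ≤ 0 * (0 + 1) * S
  d²-bound₀ zero S A B n _ = z≤n

  -- Here l = 0, so the count reduces to d ≤ n, and the area estimate gives n² ≤ 2S.
  d²-bound₁ : ∀ d S A B n → 2 * (1 * d) ≤ (1 * 1 + 1) * n + 0 * (A + B) →
    1 * (n * n) + (A * A + B * B) ≤ 2 * (1 * S) → d * d ≤ 1 * (1 + 1) * S
  d²-bound₁ d S A B n h₁ h₂ = begin
    d * d                            ≤⟨ *-mono-≤ d≤n d≤n ⟩
    n * n                            ≤⟨ m≤m+n (n * n) _ ⟩
    n * n + (A * A + B * B)          ≡⟨ cong (_+ (A * A + B * B)) (*-identityˡ (n * n)) ⟨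
    1 * (n * n) + (A * A + B * B)    ≤⟨ h₂ ⟩
    2 * (1 * S)                      ≡⟨ cong (2 *_) (*-identityˡ S) ⟩
    2 * S                            ∎
    where
    e₁ : ∀ d → 2 * d ≡ 2 * (1 * d)
    e₁ = solve-∀
    e₂ : ∀ n G → (1 * 1 + 1) * n + 0 * G ≡ 2 * n
    e₂ = solve-∀
    d≤n : d ≤ n
    d≤n = *-cancelˡ-≤ 2 (begin
      2 * d ≡⟨ e₁ d ⟩
      2 * (1 * d) ≤⟨ h₁ ⟩
      (1 * 1 + 1) * n + 0 * (A + B) ≡⟨ e₂ n (A + B) ⟩
      2 * n ∎)

  -- With G = A + B the count is 2d ≤ 3n + G. Squaring and 2nG ≤ n² + G² give 4d² ≤ 12n² + 4G²,
  -- which is at most 6(2n² + G²).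
  d²-bound₂ : ∀ d S A B n → 2 * (1 * d) ≤ (1 * 2 + 1) * n + 1 * (A + B) →
    1 * (n * n) + (A * A + B * B) ≤ 2 * (1 * S) → d * d ≤ 2 * (2 + 1) * S
  d²-bound₂ d S A B n h₁ h₂ = *-cancelˡ-≤ 4 (begin
    4 * (d * d)                                   ≡⟨ e₁ d ⟩
    (2 * (1 * d)) * (2 * (1 * d))                 ≤⟨ *-mono-≤ h₁ h₁ ⟩
    ((1 * 2 + 1) * n + 1 * G) * ((1 * 2 + 1) * n + 1 * G) ≡⟨ e₂ n G ⟩
    9 * (n * n) + G * G + 3 * (2 * (n * G))       ≤⟨ +-monoʳ-≤ (9 * (n * n) + G * G) (*-monoʳ-≤ 3 (2mn≤m²+n² n G)) ⟩
    9 * (n * n) + G * G + 3 * (n * n + G * G)     ≤⟨ m≤m+n _ (2 * (G * G)) ⟩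
    9 * (n * n) + G * G + 3 * (n * n + G * G) + 2 * (G * G) ≡⟨ e₃ n G ⟩
    6 * (2 * (1 * (n * n)) + G * G)               ≤⟨ *-monoʳ-≤ 6 (area-sum 1 n A B S h₂) ⟩
    6 * (4 * (1 * S))                             ≡⟨ e₄ S ⟩
    4 * (6 * S)                                   ∎)
    where
    G = A + B
    e₁ : ∀ d → 4 * (d * d) ≡ (2 * (1 * d)) * (2 * (1 * d))
    e₁ = solve-∀
    e₂ : ∀ n G → ((1 * 2 + 1) * n + 1 * G) * ((1 * 2 + 1) * n + 1 * G) ≡ 9 * (n * n) + G * G + 3 * (2 * (n * G))
    e₂ = solve-∀
    e₃ : ∀ n G → 9 * (n * n) + G * G + 3 * (n * n + G * G) + 2 * (G * G) ≡ 6 * (2 * (1 * (n * n)) + G * G)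
    e₃ = solve-∀
    e₄ : ∀ S → 6 * (4 * (1 * S)) ≡ 4 * (6 * S)
    e₄ = solve-∀

  -- The error is `suc α`. After squaring, the cross term is read as twice the product of 2αn and (2
  -- + α)G: with this choice the coefficients of n² and G² keep the ratio 4 : 1 found in `area-sum`
  -- for c = 2. The slack is then 2α(4n² + G²).
  d²-bound₃ : ∀ α d S A B n → 2 * (2 * d) ≤ (2 * suc α + 2) * n + α * (A + B) →
    2 * (n * n) + (A * A + B * B) ≤ 2 * (2 * S) → d * d ≤ suc α * (suc α + 1) * S
  d²-bound₃ α d S A B n h₁ h₂ = *-cancelˡ-≤ 16 (begin
    16 * (d * d)                                  ≡⟨ e₁ d ⟩
    (2 * (2 * d)) * (2 * (2 * d))                 ≤⟨ *-mono-≤ h₁ h₁ ⟩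
    ((2 * suc α + 2) * n + α * G) * ((2 * suc α + 2) * n + α * G)
      ≡⟨ e₂ α n G ⟩
    4 * ((2 + α) * (2 + α) * (n * n)) + α * α * (G * G) + 2 * ((2 * (α * n)) * ((2 + α) * G))
      ≤⟨ +-monoʳ-≤ (4 * ((2 + α) * (2 + α) * (n * n)) + α * α * (G * G)) (2mn≤m²+n² (2 * (α * n)) ((2 + α) * G)) ⟩
    4 * ((2 + α) * (2 + α) * (n * n)) + α * α * (G * G)
      + ((2 * (α * n)) * (2 * (α * n)) + ((2 + α) * G) * ((2 + α) * G))
      ≤⟨ m≤m+n _ (2 * α * (4 * (n * n) + G * G)) ⟩
    4 * ((2 + α) * (2 + α) * (n * n)) + α * α * (G * G)
      + ((2 * (α * n)) * (2 * (α * n)) + ((2 + α) * G) * ((2 + α) * G))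
      + 2 * α * (4 * (n * n) + G * G)
      ≡⟨ e₃ α n G ⟩
    2 * (suc α * (suc α + 1)) * (2 * (2 * (n * n)) + G * G)
      ≤⟨ *-monoʳ-≤ (2 * (suc α * (suc α + 1))) (area-sum 2 n A B S h₂) ⟩
    2 * (suc α * (suc α + 1)) * (4 * (2 * S))   ≡⟨ e₄ (suc α * (suc α + 1)) S ⟩
    16 * (suc α * (suc α + 1) * S)              ∎)
    where
    G = A + B
    e₁ : ∀ d → 16 * (d * d) ≡ (2 * (2 * d)) * (2 * (2 * d))
    e₁ = solve-∀
    e₂ : ∀ α n G → ((2 * suc α + 2) * n + α * G) * ((2 * suc α + 2) * n + α * G) ≡
      4 * ((2 + α) * (2 + α) * (n * n)) + α * α * (G * G) + 2 * ((2 * (α * n)) * ((2 + α) * G))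
    e₂ = solve-∀
    e₃ : ∀ α n G → 4 * ((2 + α) * (2 + α) * (n * n)) + α * α * (G * G)
      + ((2 * (α * n)) * (2 * (α * n)) + ((2 + α) * G) * ((2 + α) * G))
      + 2 * α * (4 * (n * n) + G * G) ≡ 2 * (suc α * (suc α + 1)) * (2 * (2 * (n * n)) + G * G)
    e₃ = solve-∀
    e₄ : ∀ x S → 2 * x * (4 * (2 * S)) ≡ 16 * (x * S)
    e₄ = solve-∀

-- Finite sums

private variable
  A B : Set

∑ : List A → (A → ℕ) → ℕ
∑ xs φ = sum (map φ xs)

∑-cong : ∀ (xs : List A) {φ ψ : A → ℕ} → (∀ {x} → x ∈ xs → φ x ≡ ψ x) → ∑ xs φ ≡ ∑ xs ψ
∑-cong []       eq = refl
∑-cong (x ∷ xs) eq = cong₂ _+_ (eq (here refl)) (∑-cong xs (λ x∈ → eq (there x∈)))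

∑-mono : ∀ (xs : List A) {φ ψ : A → ℕ} → (∀ {x} → x ∈ xs → φ x ≤ ψ x) → ∑ xs φ ≤ ∑ xs ψ
∑-mono []       le = z≤n
∑-mono (x ∷ xs) le = +-mono-≤ (le (here refl)) (∑-mono xs (λ x∈ → le (there x∈)))

∑-+ : ∀ (xs : List A) (φ ψ : A → ℕ) → ∑ xs (λ x → φ x + ψ x) ≡ ∑ xs φ + ∑ xs ψ
∑-+ []       φ ψ = refl
∑-+ (x ∷ xs) φ ψ = trans (cong (φ x + ψ x +_) (∑-+ xs φ ψ)) (interchange (φ x) (ψ x) _ _)
  where
  interchange : ∀ a b c d → a + b + (c + d) ≡ a + c + (b + d)
  interchange = solve-∀

∑-const : ∀ (xs : List A) k → ∑ xs (λ _ → k) ≡ length xs * k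
∑-const []       k = refl
∑-const (x ∷ xs) k = cong (k +_) (∑-const xs k)

∑-zero : ∀ (xs : List A) {φ : A → ℕ} → (∀ {x} → x ∈ xs → φ x ≡ 0) → ∑ xs φ ≡ 0
∑-zero xs eq = trans (∑-cong xs eq) (trans (∑-const xs 0) (*-zeroʳ (length xs)))

∑-++ : ∀ (xs ys : List A) (φ : A → ℕ) → ∑ (xs ++ ys) φ ≡ ∑ xs φ + ∑ ys φ
∑-++ xs ys φ = trans (cong sum (map-++ φ xs ys)) (sum-++ (map φ xs) (map φ ys))

∑-swap : ∀ (xs : List A) (ys : List B) (φ : A → B → ℕ) →
  ∑ xs (λ x → ∑ ys (φ x)) ≡ ∑ ys (λ y → ∑ xs (λ x → φ x y))
∑-swap []       ys φ = sym (∑-zero ys (λ _ → refl))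
∑-swap (x ∷ xs) ys φ = trans (cong (∑ ys (φ x) +_) (∑-swap xs ys φ))
  (sym (∑-+ ys (φ x) (λ y → ∑ xs (λ x → φ x y))))

-- Both φ ∸ ψ + ψ and ψ ∸ φ + φ are the pointwise maximum, so equal totals force surplus and deficit
-- to agree.
∑-∸-sym : ∀ (xs : List A) (φ ψ : A → ℕ) → ∑ xs φ ≡ ∑ xs ψ →
  ∑ xs (λ x → φ x ∸ ψ x) ≡ ∑ xs (λ x → ψ x ∸ φ x)
∑-∸-sym xs φ ψ φ≡ψ = +-cancelʳ-≡ (∑ xs ψ) _ _ (begin
  ∑ xs (λ x → φ x ∸ ψ x) + ∑ xs ψ      ≡⟨ ∑-+ xs _ ψ ⟨
  ∑ xs (λ x → φ x ∸ ψ x + ψ x)         ≡⟨ ∑-cong xs (λ {x} _ → m∸n+n≡n∸m+m (φ x) (ψ x)) ⟩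
  ∑ xs (λ x → ψ x ∸ φ x + φ x)         ≡⟨ ∑-+ xs _ φ ⟩
  ∑ xs (λ x → ψ x ∸ φ x) + ∑ xs φ      ≡⟨ cong (∑ xs (λ x → ψ x ∸ φ x) +_) φ≡ψ ⟩
  ∑ xs (λ x → ψ x ∸ φ x) + ∑ xs ψ      ∎)
  where
  open ≡-Reasoning
  m∸n+n≡n∸m+m : ∀ m n → m ∸ n + n ≡ n ∸ m + m
  m∸n+n≡n∸m+m zero    zero    = refl
  m∸n+n≡n∸m+m zero    (suc n) = cong suc (sym (+-identityʳ n))
  m∸n+n≡n∸m+m (suc m) zero    = cong suc (+-identityʳ m)
  m∸n+n≡n∸m+m (suc m) (suc n) = trans (+-suc (m ∸ n) n)
    (trans (cong suc (m∸n+n≡n∸m+m m n)) (sym (+-suc (n ∸ m) m)))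

-- A partition of a list is recorded only through its effect on sums, so the order of the entries
-- never matters; facts about membership are carried separately.
record _SplitsInto_,_ {A : Set} (xs ys zs : List A) : Set where
  constructor splitting
  field ∑-split : ∀ φ → ∑ xs φ ≡ ∑ ys φ + ∑ zs φ
open _SplitsInto_,_

splits-sym : ∀ {xs ys zs : List A} → xs SplitsInto ys , zs → xs SplitsInto zs , ys
splits-sym {ys = ys} {zs} s .∑-split φ = trans (∑-split s φ) (+-comm (∑ ys φ) (∑ zs φ))

++-splits : ∀ (xs ys : List A) → (xs ++ ys) SplitsInto xs , ys
++-splits xs ys .∑-split = ∑-++ xs ys

-- Pointwise φ ≤ ψ + (φ ∸ ψ), and extending the truncated differences from `ys` to all of `xs` only
-- adds nonnegative terms.
∑-∸-bound : ∀ {xs ys zs : List A} → xs SplitsInto ys , zs → ∀ (φ ψ : A → ℕ) →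
  ∑ ys φ ≤ ∑ ys ψ + ∑ xs (λ x → φ x ∸ ψ x)
∑-∸-bound {xs = xs} {ys} {zs} split φ ψ = begin
  ∑ ys φ                                   ≤⟨ ∑-mono ys (λ {x} _ → m≤n+m∸n (φ x) (ψ x)) ⟩
  ∑ ys (λ x → ψ x + (φ x ∸ ψ x))           ≡⟨ ∑-+ ys ψ _ ⟩
  ∑ ys ψ + ∑ ys (λ x → φ x ∸ ψ x)          ≤⟨ +-monoʳ-≤ (∑ ys ψ) (m≤m+n _ (∑ zs _)) ⟩
  ∑ ys ψ + (∑ ys (λ x → φ x ∸ ψ x) + ∑ zs (λ x → φ x ∸ ψ x)) ≡⟨ cong (∑ ys ψ +_) (∑-split split _) ⟨
  ∑ ys ψ + ∑ xs (λ x → φ x ∸ ψ x)          ∎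
  where open ≤-Reasoning

x+[y+z]≡y+[x+z] : ∀ x y z → x + (y + z) ≡ y + (x + z)
x+[y+z]≡y+[x+z] = solve-∀

filter-splits : ∀ {P : Pred A 0ℓ} (P? : Decidable P) (xs : List A) →
  xs SplitsInto filter P? xs , filter (λ x → ¬? (P? x)) xs
filter-splits P? []       .∑-split φ = refl
filter-splits P? (x ∷ xs) .∑-split φ with P? x
... | yes _ = trans (cong (φ x +_) (∑-split (filter-splits P? xs) φ)) (sym (+-assoc (φ x) _ _))
... | no  _ = trans (cong (φ x +_) (∑-split (filter-splits P? xs) φ))
  (x+[y+z]≡y+[x+z] (φ x) (∑ (filter P? xs) φ) (∑ (filter (λ x → ¬? (P? x)) xs) φ))

SplitsInto-length : ∀ (xs ys zs : List A) → xs SplitsInto ys , zs → length xs ≡ length ys + length zs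
SplitsInto-length xs ys zs split = begin
  length xs                              ≡⟨ length≡∑ xs ⟩
  ∑ xs (λ _ → 1)                         ≡⟨ ∑-split split (λ _ → 1) ⟩
  ∑ ys (λ _ → 1) + ∑ zs (λ _ → 1)        ≡⟨ cong₂ _+_ (length≡∑ ys) (length≡∑ zs) ⟨
  length ys + length zs                  ∎
  where
  open ≡-Reasoning
  length≡∑ : ∀ (xs : List A) → length xs ≡ ∑ xs (λ _ → 1)
  length≡∑ xs = sym (trans (∑-const xs 1) (*-identityʳ (length xs)))

-- Double sums over a grid

∬ : List A → List B → (A → B → ℕ) → ℕ
∬ xs ys φ = ∑ xs λ x → ∑ ys (φ x)

module _ (xs : List A) (ys : List B) where
  ∬-cong : {φ ψ : A → B → ℕ} → (∀ {x y} → x ∈ xs → y ∈ ys → φ x y ≡ ψ x y) → ∬ xs ys φ ≡ ∬ xs ys ψ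
  ∬-cong eq = ∑-cong xs λ x∈ → ∑-cong ys λ y∈ → eq x∈ y∈

  ∬-+ : (φ ψ : A → B → ℕ) → ∬ xs ys (λ x y → φ x y + ψ x y) ≡ ∬ xs ys φ + ∬ xs ys ψ
  ∬-+ φ ψ = trans (∑-cong xs (λ {x} _ → ∑-+ ys (φ x) (ψ x))) (∑-+ xs _ _)

  ∬-zero : {φ : A → B → ℕ} → (∀ {x y} → x ∈ xs → y ∈ ys → φ x y ≡ 0) → ∬ xs ys φ ≡ 0
  ∬-zero eq = ∑-zero xs λ x∈ → ∑-zero ys λ y∈ → eq x∈ y∈

  ∬-one : ∬ xs ys (λ _ _ → 1) ≡ length xs * length ys
  ∬-one = trans (∑-const xs _) (cong (length xs *_) (trans (∑-const ys 1) (*-identityʳ _)))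

  ∬-mono : {φ ψ : A → B → ℕ} → (∀ {x y} → x ∈ xs → y ∈ ys → φ x y ≤ ψ x y) → ∬ xs ys φ ≤ ∬ xs ys ψ
  ∬-mono le = ∑-mono xs λ x∈ → ∑-mono ys λ y∈ → le x∈ y∈

∬-splitˡ : ∀ {xs xs₁ xs₂ : List A} (ys : List B) → xs SplitsInto xs₁ , xs₂ →
  ∀ φ → ∬ xs ys φ ≡ ∬ xs₁ ys φ + ∬ xs₂ ys φ
∬-splitˡ ys split φ = ∑-split split λ x → ∑ ys (φ x)

∬-splitʳ : ∀ (xs : List A) {ys ys₁ ys₂ : List B} → ys SplitsInto ys₁ , ys₂ →
  ∀ φ → ∬ xs ys φ ≡ ∬ xs ys₁ φ + ∬ xs ys₂ φ
∬-splitʳ xs split φ = trans (∑-cong xs (λ {x} _ → ∑-split split (φ x))) (∑-+ xs _ _)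

ind : Bool → ℕ
ind true  = 1
ind false = 0

ind≤1 : ∀ b → ind b ≤ 1
ind≤1 true  = ≤-refl
ind≤1 false = z≤n

∈⇒length≡suc : ∀ {x} {xs : List A} → x ∈ xs → ∃[ k ] length xs ≡ suc k
∈⇒length≡suc {xs = _ ∷ xs} _ = length xs , refl

-- Matrices without switching components

-- Equivalently, the supports of any two rows are comparable under inclusion.
SwitchingFree : (A → B → Bool) → Set
SwitchingFree f = ∀ {a a′ b b′} → f a b ≡ true → f a′ b′ ≡ true → f a b′ ≡ false → f a′ b ≡ false → ⊥

RowNonempty : (A → B → Bool) → List B → A → Set
RowNonempty f ys a = ∃[ b ] b ∈ ys × f a b ≡ true

-- The columns met by the smallest row are full. Inductively, let b be full on the later rows. If
-- row a misses b, take any b′ in row a: a later row missing b′ would form a switching component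
-- with a, so b′ is full.
full-column : ∀ {f : A → B → Bool} → SwitchingFree f → ∀ a (xs : List A) (ys : List B) →
  (∀ {x} → x ∈ a ∷ xs → RowNonempty f ys x) → ∃[ b ] b ∈ ys × (∀ {x} → x ∈ a ∷ xs → f x b ≡ true)
full-column sf a [] ys ne with b , b∈ , fab ← ne (here refl) = b , b∈ , λ { (here refl) → fab }
full-column {f = f} sf a (a′ ∷ xs) ys ne with full-column sf a′ xs ys (λ x∈ → ne (there x∈))
... | b , b∈ , full with f a b in fab
...   | true  = b , b∈ , λ { (here refl) → fab ; (there x∈) → full x∈ }
...   | false with b′ , b′∈ , fab′ ← ne (here refl) =
  b′ , b′∈ , λ { (here refl) → fab′ ; (there x∈) → Bool.¬-not (λ fxb′ → sf (full x∈) fab′ fxb′ fab) }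

-- Rows and columns of a staircase matrix are peeled off along its boundary: first the columns C₁ that
-- are full on the remaining rows, then the rows R₁ that are empty on the remaining columns.
module Staircase {A B : Set} (f : A → B → Bool) (D : A → B → ℕ)
  (switchingFree : SwitchingFree f) (D≤f : ∀ a b → D a b ≤ ind (f a b))
  (rows : List A) (cols : List B) (c α k l : ℕ) (blockBound : BlockBound c α k l)
  (rectangle-bound : ∀ R Rᶜ Q Qᶜ → rows SplitsInto R , Rᶜ → cols SplitsInto Q , Qᶜ →
    (∀ {a b} → a ∈ R → b ∈ Q → f a b ≡ true) →
    (∀ {a b} → a ∈ Rᶜ → b ∈ Qᶜ → f a b ≡ false) →
    ∬ R Q D ≤ α)
  where

  F : A → B → ℕ
  F a b = ind (f a b)

  F≡1 : ∀ {a b} → f a b ≡ true → F a b ≡ 1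
  F≡1 = cong ind

  F≡0 : ∀ {a b} → f a b ≡ false → F a b ≡ 0
  F≡0 = cong ind

  D≡0 : ∀ {a b} → f a b ≡ false → D a b ≡ 0
  D≡0 fab = n≤0⇒n≡0 (≤-trans (D≤f _ _) (≤-reflexive (F≡0 fab)))

  -- n counts the corners met from this stage on; a and b are the sums of the capped excess widths and
  -- heights of the corner blocks. Points in the removed columns Q carry weight 1, since one of the two
  -- corner rectangles they are charged to has already been passed.
  record Profile (R : List A) (Q C : List B) : Set where
    field
      n a b : ℕ
      a≤cn  : a ≤ c * n
      n+b≤R : n + b ≤ length R
      area  : c * (n * n) + (a * a + b * b) ≤ 2 * (c * ∬ R C F)
      count : c * (2 * ∬ R C D + ∬ R Q D) ≤ (c * α + k) * n + l * (a + b)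

  -- The invariants `full` and `empty` have the shape required by `rectangle-bound`. They survive
  -- moving `C₁` to the removed columns and then `R₁` to the removed rows.
  module Step (r : A) (R₀ Rᶜ : List A) (Q C : List B)
    (rows-split : rows SplitsInto (r ∷ R₀) , Rᶜ) (cols-split : cols SplitsInto Q , C)
    (nonempty : ∀ {a} → a ∈ r ∷ R₀ → RowNonempty f C a)
    (full : ∀ {a b} → a ∈ r ∷ R₀ → b ∈ Q → f a b ≡ true)
    (empty : ∀ {a b} → a ∈ Rᶜ → b ∈ C → f a b ≡ false)
    where
    R = r ∷ R₀

    full? : Decidable (λ b → All (λ a → f a b ≡ true) R)
    full? b = all? (λ a → f a b Bool.≟ true) R

    C₁ = filter full? C
    C₂ = filter (λ b → ¬? (full? b)) C

    empty? : Decidable (λ a → All (λ b → f a b ≡ false) C₂)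
    empty? a = all? (λ b → f a b Bool.≟ false) C₂

    R₁ = filter empty? R
    R₂ = filter (λ a → ¬? (empty? a)) R

    C-split : C SplitsInto C₁ , C₂
    C-split = filter-splits full? C

    R-split : R SplitsInto R₁ , R₂
    R-split = filter-splits empty? R

    full₁ : ∀ {a b} → a ∈ R → b ∈ C₁ → f a b ≡ true
    full₁ a∈ b∈ = All.lookup (proj₂ (∈-filter⁻ full? {xs = C} b∈)) a∈

    empty₁ : ∀ {a b} → a ∈ R₁ → b ∈ C₂ → f a b ≡ false
    empty₁ a∈ b∈ = All.lookup (proj₂ (∈-filter⁻ empty? {xs = R} a∈)) b∈

    nonempty⁺ : ∀ {a} → ¬ All (λ b → f a b ≡ false) C₂ → RowNonempty f C₂ a
    nonempty⁺ {a} ¬empty with b , b∈ , ¬fab ← find (¬All⇒Any¬ (λ b → f a b Bool.≟ false) C₂ ¬empty) =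
      b , b∈ , Bool.¬-not ¬fab

    R₂⊆R : ∀ {a} → a ∈ R₂ → a ∈ R
    R₂⊆R a∈ = proj₁ (∈-filter⁻ (λ a → ¬? (empty? a)) {xs = R} a∈)

    C₂⊆C : ∀ {b} → b ∈ C₂ → b ∈ C
    C₂⊆C b∈ = proj₁ (∈-filter⁻ (λ b → ¬? (full? b)) {xs = C} b∈)

    ∃C₁ : ∃[ w ] length C₁ ≡ suc w
    ∃C₁ with b , b∈ , fullb ← full-column switchingFree r R₀ C nonempty =
      ∈⇒length≡suc (∈-filter⁺ full? b∈ (All.tabulate fullb))

    -- If every row of `R` met `C₂`, then `full-column` would yield a column of `C₂` full on `R`,
    -- which belongs to `C₁`. This makes the peeling terminate.
    ∃R₁ : ∃[ h ] length R₁ ≡ suc h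
    ∃R₁ with all? (λ a → ¬? (empty? a)) R
    ... | yes ¬empty with b , b∈ , fullb ← full-column switchingFree r R₀ C₂ (λ a∈ → nonempty⁺ (All.lookup ¬empty a∈)) =
      ⊥-elim (proj₂ (∈-filter⁻ (λ b → ¬? (full? b)) {xs = C} b∈) (All.tabulate fullb))
    ... | no ¬∀ with a , a∈ , ¬¬e ← find (¬All⇒Any¬ (λ a → ¬? (empty? a)) R ¬∀) with empty? a
    ...   | yes e = ∈⇒length≡suc (∈-filter⁺ empty? a∈ e)
    ...   | no ¬e = ⊥-elim (¬¬e ¬e)

    w = proj₁ ∃C₁
    h = proj₁ ∃R₁

    R-length : length R ≡ suc h + length R₂
    R-length = trans (SplitsInto-length R R₁ R₂ R-split) (cong (_+ length R₂) (proj₂ ∃R₁))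

    module _ (φ : A → B → ℕ) (φ≡0 : ∀ {a b} → f a b ≡ false → φ a b ≡ 0) where
      -- The third piece, `R₁` × `C₂`, is empty by the choice of `R₁`.
      ∬-RC : ∬ R C φ ≡ ∬ R C₁ φ + ∬ R₂ C₂ φ
      ∬-RC = begin
        ∬ R C φ                                 ≡⟨ ∬-splitʳ R C-split φ ⟩
        ∬ R C₁ φ + ∬ R C₂ φ                     ≡⟨ cong (∬ R C₁ φ +_) (∬-splitˡ C₂ R-split φ) ⟩
        ∬ R C₁ φ + (∬ R₁ C₂ φ + ∬ R₂ C₂ φ)      ≡⟨ cong (λ x → ∬ R C₁ φ + (x + ∬ R₂ C₂ φ))
                                                     (∬-zero R₁ C₂ (λ a∈ b∈ → φ≡0 (empty₁ a∈ b∈))) ⟩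
        ∬ R C₁ φ + ∬ R₂ C₂ φ                    ∎
        where open ≡-Reasoning

    ∬F : ∬ R C F ≡ suc w * (suc h + length R₂) + ∬ R₂ C₂ F
    ∬F = trans (∬-RC F F≡0) (cong (_+ ∬ R₂ C₂ F) (begin
      ∬ R C₁ F                          ≡⟨ ∬-cong R C₁ (λ a∈ b∈ → F≡1 (full₁ a∈ b∈)) ⟩
      ∬ R C₁ (λ _ _ → 1)                ≡⟨ ∬-one R C₁ ⟩
      length R * length C₁              ≡⟨ cong₂ _*_ R-length (proj₂ ∃C₁) ⟩
      (suc h + length R₂) * suc w       ≡⟨ *-comm (suc h + length R₂) (suc w) ⟩
      suc w * (suc h + length R₂)       ∎))
      where open ≡-Reasoning

    block≤ : ∬ R₁ C₁ D ≤ suc w * suc h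
    block≤ = begin
      ∬ R₁ C₁ D              ≤⟨ ∬-mono R₁ C₁ (λ {a} {b} _ _ → ≤-trans (D≤f a b) (ind≤1 (f a b))) ⟩
      ∬ R₁ C₁ (λ _ _ → 1)    ≡⟨ ∬-one R₁ C₁ ⟩
      length R₁ * length C₁  ≡⟨ cong₂ _*_ (proj₂ ∃R₁) (proj₂ ∃C₁) ⟩
      suc h * suc w          ≡⟨ *-comm (suc h) (suc w) ⟩
      suc w * suc h          ∎
      where open ≤-Reasoning

    full₂ : ∀ {a b} → a ∈ R → b ∈ C₁ ++ Q → f a b ≡ true
    full₂ a∈ b∈ with ∈-++⁻ C₁ b∈
    ... | inj₁ b∈C₁ = full₁ a∈ b∈C₁
    ... | inj₂ b∈Q  = full a∈ b∈Q

    cols-split₂ : cols SplitsInto (C₁ ++ Q) , C₂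
    cols-split₂ .∑-split φ = trans (∑-split cols-split φ) (trans (cong (∑ Q φ +_) (∑-split C-split φ))
      (trans (rearrange (∑ Q φ) (∑ C₁ φ) (∑ C₂ φ)) (cong (_+ ∑ C₂ φ) (sym (∑-++ C₁ Q φ)))))
      where
      rearrange : ∀ q x y → q + (x + y) ≡ x + q + y
      rearrange = solve-∀

    -- The three sums together cover the rectangle `R` × (`C₁ ++ Q`), which is full and whose
    -- opposite rectangle `Rᶜ` × `C₂` is empty.
    corner≤ : ∬ R₁ C₁ D + ∬ R₂ C₁ D + ∬ R Q D ≤ α
    corner≤ = begin
      ∬ R₁ C₁ D + ∬ R₂ C₁ D + ∬ R Q D  ≡⟨ cong (_+ ∬ R Q D) (∬-splitˡ C₁ R-split D) ⟨
      ∬ R C₁ D + ∬ R Q D               ≡⟨ ∬-splitʳ R (++-splits C₁ Q) D ⟨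
      ∬ R (C₁ ++ Q) D                  ≤⟨ rectangle-bound R Rᶜ (C₁ ++ Q) C₂ rows-split cols-split₂ full₂
                                            (λ a∈ b∈ → empty a∈ (C₂⊆C b∈)) ⟩
      α                                ∎
      where open ≤-Reasoning

    extend : Profile R₂ (C₁ ++ Q) C₂ → Profile R Q C
    extend P = record
      { n = suc n ; a = c ⊓ w + a ; b = c ⊓ h + b
      ; a≤cn = ≤-trans (+-mono-≤ (m⊓n≤m c w) a≤cn) (≤-reflexive (sym (*-suc c n)))
      ; n+b≤R = begin
          suc n + (c ⊓ h + b)           ≡⟨ shuffle n (c ⊓ h) b ⟩
          suc (c ⊓ h) + (n + b)         ≤⟨ +-mono-≤ (s≤s (m⊓n≤n c h)) n+b≤R ⟩
          suc h + length R₂             ≡⟨ R-length ⟨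
          length R                      ∎
      ; area = ≤-trans (area-step c n a b (∬ R₂ C₂ F) (length R₂) h w a≤cn n+b≤R area)
                 (≤-reflexive (cong (λ x → 2 * (c * x)) (sym ∬F)))
      ; count = begin
          c * (2 * ∬ R C D + ∬ R Q D)
            ≡⟨ cong (λ s → c * (2 * s + ∬ R Q D)) (trans (∬-RC D D≡0) (cong (_+ z) (∬-splitˡ C₁ R-split D))) ⟩
          c * (2 * (x + y + z) + ∬ R Q D)
            -- The current rectangle pays once for x, y and `R` × `Q`. The second copy of x is paid
            -- by `blockBound`; the second copy of y and both copies of z are left to the later
            -- corners.
            ≡⟨ regroup c x y z (∬ R Q D) ⟩
          c * (x + y + ∬ R Q D) + (c * x + c * (2 * z + y))
            ≤⟨ +-mono-≤ (*-monoʳ-≤ c corner≤) (+-mono-≤ (blockBound x w h x≤α block≤) rest) ⟩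
          c * α + ((k + l * (c ⊓ w + c ⊓ h)) + ((c * α + k) * n + l * (a + b)))
            ≡⟨ collect c α k l n (c ⊓ w) (c ⊓ h) a b ⟩
          (c * α + k) * suc n + l * (c ⊓ w + a + (c ⊓ h + b)) ∎
      }
      where
      open Profile P
      open ≤-Reasoning
      x = ∬ R₁ C₁ D
      y = ∬ R₂ C₁ D
      z = ∬ R₂ C₂ D
      x≤α : x ≤ α
      x≤α = ≤-trans (≤-trans (m≤m+n x y) (m≤m+n (x + y) _)) corner≤
      rest : c * (2 * z + y) ≤ (c * α + k) * n + l * (a + b)
      -- The removed columns of the next stage are `C₁ ++ Q`; enlarging y by the points over `R₂` ×
      -- `Q` matches its `count`.
      rest = ≤-trans
        (*-monoʳ-≤ c (+-monoʳ-≤ (2 * z)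
          (≤-trans (m≤m+n y (∬ R₂ Q D)) (≤-reflexive (sym (∬-splitʳ R₂ (++-splits C₁ Q) D))))))
        count
      shuffle : ∀ n h b → suc n + (h + b) ≡ suc h + (n + b)
      shuffle = solve-∀
      regroup : ∀ c x y z q → c * (2 * (x + y + z) + q) ≡ c * (x + y + q) + (c * x + c * (2 * z + y))
      regroup = solve-∀
      collect : ∀ c α k l n w h a b → c * α + ((k + l * (w + h)) + ((c * α + k) * n + l * (a + b)))
        ≡ (c * α + k) * suc n + l * (w + a + (h + b))
      collect = solve-∀

  -- `R₂` is a filtered list, not a structural part of `R`, so the recursion runs on a bound `m` for
  -- the number of rows; it drops because `R₁` is nonempty.
  profile : ∀ m R Rᶜ Q C → length R ≤ m → rows SplitsInto R , Rᶜ → cols SplitsInto Q , C →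
    (∀ {a} → a ∈ R → RowNonempty f C a) →
    (∀ {a b} → a ∈ R → b ∈ Q → f a b ≡ true) →
    (∀ {a b} → a ∈ Rᶜ → b ∈ C → f a b ≡ false) →
    Profile R Q C
  profile m [] Rᶜ Q C R≤m rows-split cols-split nonempty full empty = record
    { n = 0 ; a = 0 ; b = 0 ; a≤cn = z≤n ; n+b≤R = z≤n
    ; area = ≤-trans (≤-reflexive (cong (_+ 0) (*-zeroʳ c))) z≤n
    ; count = ≤-trans (≤-reflexive (*-zeroʳ c)) z≤n }
  profile (suc m) (r ∷ R₀) Rᶜ Q C (s≤s R≤m) rows-split cols-split nonempty full empty =
    extend (profile m R₂ (R₁ ++ Rᶜ) (C₁ ++ Q) C₂ R₂≤m rows-split₂ cols-split₂
      (λ a∈ → nonempty⁺ (proj₂ (∈-filter⁻ (λ a → ¬? (empty? a)) {xs = R} a∈)))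
      (λ a∈ → full₂ (R₂⊆R a∈)) empty₂)
    where
    open Step r R₀ Rᶜ Q C rows-split cols-split nonempty full empty
    rearrange : ∀ x y z → x + y + z ≡ y + (x + z)
    rearrange = solve-∀
    rows-split₂ : rows SplitsInto R₂ , (R₁ ++ Rᶜ)
    rows-split₂ .∑-split φ = trans (∑-split rows-split φ) (trans (cong (_+ ∑ Rᶜ φ) (∑-split R-split φ))
      (trans (rearrange (∑ R₁ φ) (∑ R₂ φ) (∑ Rᶜ φ)) (cong (∑ R₂ φ +_) (sym (∑-++ R₁ Rᶜ φ)))))
    R₂≤m : length R₂ ≤ m
    R₂≤m = ≤-trans (m≤n+m (length R₂) h) (≤-trans (≤-reflexive (suc-injective (sym R-length))) R≤m)
    empty₂ : ∀ {a b} → a ∈ R₁ ++ Rᶜ → b ∈ C₂ → f a b ≡ false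
    empty₂ a∈ b∈ with ∈-++⁻ R₁ a∈
    ... | inj₁ a∈R₁ = empty₁ a∈R₁ b∈
    ... | inj₂ a∈Rᶜ = empty a∈Rᶜ (C₂⊆C b∈)

  -- Peeling starts with no removed columns and with the rows that miss every column set aside;
  -- these contribute nothing to either sum.
  total-profile : ∃[ n ] ∃[ a ] ∃[ b ]
    c * (n * n) + (a * a + b * b) ≤ 2 * (c * ∬ rows cols F) ×
    2 * (c * ∬ rows cols D) ≤ (c * α + k) * n + l * (a + b)
  total-profile = n , a , b ,
    subst (λ s → c * (n * n) + (a * a + b * b) ≤ 2 * (c * s)) (sym (restrict F F≡0)) area ,
    (begin
      2 * (c * ∬ rows cols D)             ≡⟨ cong (λ s → 2 * (c * s)) (restrict D D≡0) ⟩
      2 * (c * ∬ R cols D)                ≡⟨ rearrange c (∬ R cols D) ⟩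
      c * (2 * ∬ R cols D)                ≤⟨ *-monoʳ-≤ c (m≤m+n _ (∬ R [] D)) ⟩
      c * (2 * ∬ R cols D + ∬ R [] D)     ≤⟨ count ⟩
      (c * α + k) * n + l * (a + b)   ∎)
    where
    open ≤-Reasoning
    empty? : Decidable (λ a → All (λ b → f a b ≡ false) cols)
    empty? a = all? (λ b → f a b Bool.≟ false) cols
    R  = filter (λ a → ¬? (empty? a)) rows
    Rᶜ = filter empty? rows
    empty : ∀ {a b} → a ∈ Rᶜ → b ∈ cols → f a b ≡ false
    empty a∈ b∈ = All.lookup (proj₂ (∈-filter⁻ empty? {xs = rows} a∈)) b∈
    nonempty : ∀ {a} → a ∈ R → RowNonempty f cols a
    nonempty {a} a∈ with b , b∈ , ¬fab ← find (¬All⇒Any¬ (λ b → f a b Bool.≟ false) cols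
      (proj₂ (∈-filter⁻ (λ a → ¬? (empty? a)) {xs = rows} a∈))) = b , b∈ , Bool.¬-not ¬fab
    split : rows SplitsInto R , Rᶜ
    split = splits-sym (filter-splits empty? rows)
    open Profile (profile (length R) R Rᶜ [] cols ≤-refl split (splitting λ _ → refl) nonempty (λ _ ()) empty)
    restrict : ∀ φ → (∀ {a b} → f a b ≡ false → φ a b ≡ 0) → ∬ rows cols φ ≡ ∬ R cols φ
    restrict φ φ≡0 = trans (∬-splitˡ cols split φ)
      (trans (cong (∬ R cols φ +_) (∬-zero Rᶜ cols (λ a∈ b∈ → φ≡0 (empty a∈ b∈)))) (+-identityʳ _))
    rearrange : ∀ c s → 2 * (c * s) ≡ c * (2 * s)
    rearrange = solve-∀

-- Comparing the line sums of two matrices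

module _ {A B : Set} (f g : A → B → Bool) (switchingFree : SwitchingFree f)
  (rows : List A) (cols : List B) where
  private
    F G D : A → B → ℕ
    F a b = ind (f a b)
    G a b = ind (g a b)
    D a b = ind (f a b ∧ not (g a b))

    rowF rowG : A → ℕ
    rowF a = ∑ cols (F a)
    rowG a = ∑ cols (G a)
    colF colG : B → ℕ
    colF b = ∑ rows (λ a → F a b)
    colG b = ∑ rows (λ a → G a b)

  -- On the rows `R`, F exceeds G by at most the row surplus; on the columns `Qᶜ`, G exceeds F by at
  -- most the column surplus, and there F lives only on `R` × `Qᶜ`. Adding the two cancels the sums
  -- over `R` × `Qᶜ` and leaves F - G on `R` × `Q`, which is D because F is full there.
  rectangle-bound : ∀ R Rᶜ Q Qᶜ → rows SplitsInto R , Rᶜ → cols SplitsInto Q , Qᶜ →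
    (∀ {a b} → a ∈ R → b ∈ Q → f a b ≡ true) →
    (∀ {a b} → a ∈ Rᶜ → b ∈ Qᶜ → f a b ≡ false) →
    ∬ R Q D ≤ ∑ rows (λ a → rowF a ∸ rowG a) + ∑ cols (λ b → colG b ∸ colF b)
  rectangle-bound R Rᶜ Q Qᶜ rows-split cols-split full empty =
    +-cancelʳ-≤ (∬ R Q G + ∬ R Qᶜ F + ∬ R Qᶜ G) _ _ (begin
      ∬ R Q D + (∬ R Q G + ∬ R Qᶜ F + ∬ R Qᶜ G)
        ≡⟨ regroup₁ (∬ R Q D) (∬ R Q G) _ _ ⟩
      ∬ R Q D + ∬ R Q G + ∬ R Qᶜ F + ∬ R Qᶜ G
        ≡⟨ cong (λ x → x + ∬ R Qᶜ F + ∬ R Qᶜ G) F≡D+G ⟨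
      ∬ R Q F + ∬ R Qᶜ F + ∬ R Qᶜ G
        ≤⟨ +-mono-≤ rows≤ cols≤ ⟩
      ∬ R Q G + ∬ R Qᶜ G + er + (∬ R Qᶜ F + ec)
        ≡⟨ regroup₂ (∬ R Q G) _ _ _ _ ⟩
      er + ec + (∬ R Q G + ∬ R Qᶜ F + ∬ R Qᶜ G) ∎)
    where
    open ≤-Reasoning
    er = ∑ rows (λ a → rowF a ∸ rowG a)
    ec = ∑ cols (λ b → colG b ∸ colF b)
    regroup₁ : ∀ d q x y → d + (q + x + y) ≡ d + q + x + y
    regroup₁ = solve-∀
    regroup₂ : ∀ q y r x c → q + y + r + (x + c) ≡ r + c + (q + x + y)
    regroup₂ = solve-∀
    F≡D+G : ∬ R Q F ≡ ∬ R Q D + ∬ R Q G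
    F≡D+G = trans (∬-cong R Q (λ {a} {b} a∈ b∈ → split₁ (f a b) (g a b) (full a∈ b∈))) (∬-+ R Q D G)
      where
      split₁ : ∀ x y → x ≡ true → ind x ≡ ind (x ∧ not y) + ind y
      split₁ true true  _ = refl
      split₁ true false _ = refl
    rows≤ : ∬ R Q F + ∬ R Qᶜ F ≤ ∬ R Q G + ∬ R Qᶜ G + er
    rows≤ = begin
      ∬ R Q F + ∬ R Qᶜ F            ≡⟨ ∬-splitʳ R cols-split F ⟨
      ∑ R rowF                      ≤⟨ ∑-∸-bound rows-split rowF rowG ⟩
      ∑ R rowG + er                 ≡⟨ cong (_+ er) (∬-splitʳ R cols-split G) ⟩
      ∬ R Q G + ∬ R Qᶜ G + er       ∎
    col-split : ∀ φ → ∑ Qᶜ (λ b → ∑ rows (λ a → φ a b)) ≡ ∬ R Qᶜ φ + ∬ Rᶜ Qᶜ φ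
    col-split φ = trans (sym (∑-swap rows Qᶜ φ)) (∬-splitˡ Qᶜ rows-split φ)
    cols≤ : ∬ R Qᶜ G ≤ ∬ R Qᶜ F + ec
    cols≤ = begin
      ∬ R Qᶜ G                      ≤⟨ m≤m+n _ (∬ Rᶜ Qᶜ G) ⟩
      ∬ R Qᶜ G + ∬ Rᶜ Qᶜ G          ≡⟨ col-split G ⟨
      ∑ Qᶜ colG                     ≤⟨ ∑-∸-bound (splits-sym cols-split) colG colF ⟩
      ∑ Qᶜ colF + ec                ≡⟨ cong (_+ ec) (trans (col-split F)
                                         (trans (cong (∬ R Qᶜ F +_) (∬-zero Rᶜ Qᶜ (λ a∈ b∈ → cong ind (empty a∈ b∈))))
                                           (+-identityʳ _))) ⟩
      ∬ R Qᶜ F + ec                 ∎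

  -- As F and G have equal totals, the row surplus is half the row error and the column surplus half
  -- the column error.
  row-col-error : ∬ rows cols F ≡ ∬ rows cols G → ∀ α →
    2 * α ≡ ∑ cols (λ b → absDiff (colF b) (colG b)) + ∑ rows (λ a → absDiff (rowF a) (rowG a)) →
    ∑ rows (λ a → rowF a ∸ rowG a) + ∑ cols (λ b → colG b ∸ colF b) ≡ α
  row-col-error F≡G α 2α≡ = *-cancelˡ-≡ _ α 2 (begin
    2 * (r + c)                  ≡⟨ double r c ⟩
    c + c + (r + r)              ≡⟨ cong₂ _+_ (cong (_+ c) (sym c-sym)) (cong (r +_) r-sym) ⟩
    c′ + c + (r + r′)            ≡⟨ cong₂ _+_ (∑-+ cols _ _) (∑-+ rows _ _) ⟨
    _                            ≡⟨ 2α≡ ⟨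
    2 * α                        ∎)
    where
    open ≡-Reasoning
    r r′ c c′ : ℕ
    r  = ∑ rows (λ a → rowF a ∸ rowG a)
    r′ = ∑ rows (λ a → rowG a ∸ rowF a)
    c  = ∑ cols (λ b → colG b ∸ colF b)
    c′ = ∑ cols (λ b → colF b ∸ colG b)
    double : ∀ r c → 2 * (r + c) ≡ c + c + (r + r)
    double = solve-∀
    r-sym : r ≡ r′
    r-sym = ∑-∸-sym rows rowF rowG F≡G
    c-sym : c′ ≡ c
    c-sym = ∑-∸-sym cols colF colG (trans (sym (∑-swap rows cols F)) (trans F≡G (∑-swap rows cols G)))

  matrix-bound : ∬ rows cols F ≡ ∬ rows cols G → ∀ α →
    2 * α ≡ ∑ cols (λ b → absDiff (colF b) (colG b)) + ∑ rows (λ a → absDiff (rowF a) (rowG a)) →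
    ∬ rows cols D * ∬ rows cols D ≤ α * (α + 1) * ∬ rows cols F
  matrix-bound F≡G α 2α≡ = by-α α rectangle-bound′
    where
    D≤F : ∀ a b → D a b ≤ F a b
    D≤F a b with f a b
    ... | true  = ind≤1 (not (g a b))
    ... | false = z≤n
    RectangleBound : ℕ → Set
    RectangleBound α = ∀ R Rᶜ Q Qᶜ → rows SplitsInto R , Rᶜ → cols SplitsInto Q , Qᶜ →
      (∀ {a b} → a ∈ R → b ∈ Q → f a b ≡ true) →
      (∀ {a b} → a ∈ Rᶜ → b ∈ Qᶜ → f a b ≡ false) →
      ∬ R Q D ≤ α
    rectangle-bound′ : RectangleBound α
    rectangle-bound′ R Rᶜ Q Qᶜ rs cs full empty =
      ≤-trans (rectangle-bound R Rᶜ Q Qᶜ rs cs full empty) (≤-reflexive (row-col-error F≡G α 2α≡))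
    d s : ℕ
    d = ∬ rows cols D
    s = ∬ rows cols F
    -- The error is a fresh variable here, so that splitting on it affects only the rectangle bound.
    -- The numbers passed to `total-profile` are c, the error, k and l.
    by-α : ∀ α → RectangleBound α → d * d ≤ α * (α + 1) * s
    by-α 0 rb with n , a , b , area , count ←
      Staircase.total-profile f D switchingFree D≤F rows cols 1 0 0 0 blockBound₀ rb =
      d²-bound₀ d s a b n count
    by-α 1 rb with n , a , b , area , count ←
      Staircase.total-profile f D switchingFree D≤F rows cols 1 1 1 0 (blockBound₁ 0) rb =
      d²-bound₁ d s a b n count area
    by-α 2 rb with n , a , b , area , count ←
      Staircase.total-profile f D switchingFree D≤F rows cols 1 2 1 1 (blockBound₁ 1) rb =
      d²-bound₂ d s a b n count area
    by-α (suc (suc (suc α))) rb with n , a , b , area , count ←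
      Staircase.total-profile f D switchingFree D≤F rows cols 2 (3 + α) 2 (2 + α) (blockBound₂ α) rb =
      d²-bound₃ (2 + α) d s a b n count area

-- From finite sets to matrices

_≟ₚ_ : (p q : Point) → Dec (p ≡ q)
_≟ₚ_ = ≡-dec ℤ._≟_ ℤ._≟_

does-true : ∀ {P : Set} (d : Dec P) → does d ≡ true → P
does-true (yes p) _ = p

does-false : ∀ {P : Set} (d : Dec P) → does d ≡ false → ¬ P
does-false (no ¬p) _ = ¬p

length-filter≡∑ : ∀ {P : Pred A 0ℓ} (P? : Decidable P) (xs : List A) →
  length (filter P? xs) ≡ ∑ xs (λ x → ind (does (P? x)))
length-filter≡∑ P? []       = refl
length-filter≡∑ P? (x ∷ xs) with P? x
... | yes _ = cong suc (length-filter≡∑ P? xs)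
... | no  _ = length-filter≡∑ P? xs

∑-↭ : ∀ {xs ys : List A} (φ : A → ℕ) → xs ↭ ys → ∑ xs φ ≡ ∑ ys φ
∑-↭ φ p = sum-↭ (map⁺ φ p)

∈⇒↭ : ∀ {x : A} {xs} → x ∈ xs → ∃[ ys ] xs ↭ x ∷ ys
∈⇒↭ {x = x} x∈ with ys , zs , refl ← ∈-∃++ x∈ = ys ++ zs , shift x ys zs

∑-*ˡ : ∀ (xs : List A) k φ → ∑ xs (λ x → k * φ x) ≡ k * ∑ xs φ
∑-*ˡ []       k φ = sym (*-zeroʳ k)
∑-*ˡ (x ∷ xs) k φ = trans (cong (k * φ x +_) (∑-*ˡ xs k φ)) (sym (*-distribˡ-+ k (φ x) _))

∑-*ʳ : ∀ (xs : List A) φ k → ∑ xs (λ x → φ x * k) ≡ k * ∑ xs φ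
∑-*ʳ xs φ k = trans (∑-cong xs (λ {x} _ → *-comm (φ x) k)) (∑-*ˡ xs k φ)

∑-δ : ∀ {x : ℤ} {xs} → Unique xs → x ∈ xs → ∀ (φ : ℤ → ℕ) → ∑ xs (λ a → ind (does (a ℤ.≟ x)) * φ a) ≡ φ x
∑-δ {x} {xs = _ ∷ xs} (x∉ ∷ _) (here refl) φ = trans
  (cong₂ _+_ (cong (λ t → ind t * φ x) (dec-true (x ℤ.≟ x) refl))
    (∑-zero xs (λ {a} a∈ → cong (λ t → ind t * φ a) (dec-false (a ℤ.≟ x) (λ { refl → All.lookup x∉ a∈ refl })))))
  (trans (+-identityʳ _) (+-identityʳ (φ x)))
∑-δ {x} {xs = y ∷ xs} (y∉ ∷ uniq) (there x∈) φ = trans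
  (cong (λ t → ind t * φ y + ∑ xs (λ a → ind (does (a ℤ.≟ x)) * φ a))
    (dec-false (y ℤ.≟ x) (λ { refl → All.lookup y∉ x∈ refl })))
  (∑-δ uniq x∈ φ)

module _ {rows cols : List ℤ} (rows! : Unique rows) (cols! : Unique cols) where
  ∬-δ : ∀ {q} → proj₁ q ∈ rows → proj₂ q ∈ cols → (φ : Point → ℕ) →
    ∬ rows cols (λ a b → ind (does ((a , b) ≟ₚ q)) * φ (a , b)) ≡ φ q
  ∬-δ {x , y} x∈ y∈ φ = begin
    ∬ rows cols (λ a b → ind (does ((a , b) ≟ₚ (x , y))) * φ (a , b))
      ≡⟨ ∑-cong rows (λ {a} _ → row a) ⟩
    ∑ rows (λ a → ind (does (a ℤ.≟ x)) * φ (a , y))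
      ≡⟨ ∑-δ rows! x∈ (λ a → φ (a , y)) ⟩
    φ (x , y) ∎
    where
    open ≡-Reasoning
    pair : ∀ a b → does ((a , b) ≟ₚ (x , y)) ≡ does (a ℤ.≟ x) ∧ does (b ℤ.≟ y)
    pair a b = does-⇔ (mk⇔ (λ { refl → refl , refl }) (λ { (refl , refl) → refl }))
      ((a , b) ≟ₚ (x , y)) (a ℤ.≟ x ×-dec b ℤ.≟ y)
    ind-∧ : ∀ s t k → ind (s ∧ t) * k ≡ ind s * (ind t * k)
    ind-∧ true  t k = sym (+-identityʳ _)
    ind-∧ false t k = refl
    row : ∀ a → ∑ cols (λ b → ind (does ((a , b) ≟ₚ (x , y))) * φ (a , b)) ≡ ind (does (a ℤ.≟ x)) * φ (a , y)
    row a = begin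
      ∑ cols (λ b → ind (does ((a , b) ≟ₚ (x , y))) * φ (a , b))
        ≡⟨ ∑-cong cols (λ {b} _ → trans (cong (λ t → ind t * φ (a , b)) (pair a b))
             (ind-∧ (does (a ℤ.≟ x)) (does (b ℤ.≟ y)) (φ (a , b)))) ⟩
      ∑ cols (λ b → ind (does (a ℤ.≟ x)) * (ind (does (b ℤ.≟ y)) * φ (a , b)))
        ≡⟨ ∑-*ˡ cols (ind (does (a ℤ.≟ x))) _ ⟩
      ind (does (a ℤ.≟ x)) * ∑ cols (λ b → ind (does (b ℤ.≟ y)) * φ (a , b))
        ≡⟨ cong (ind (does (a ℤ.≟ x)) *_) (∑-δ cols! y∈ (λ b → φ (a , b))) ⟩
      ind (does (a ℤ.≟ x)) * φ (a , y) ∎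

  -- The head of the list contributes a Kronecker delta on the grid; since it does not recur in the
  -- tail, adding the delta to the indicator of the tail gives the indicator of the whole list.
  ∑≡∬ : ∀ (L : List Point) → Unique L → (∀ {q} → q ∈ L → proj₁ q ∈ rows) → (∀ {q} → q ∈ L → proj₂ q ∈ cols) →
    (φ : Point → ℕ) → ∑ L φ ≡ ∬ rows cols (λ a b → ind (does (_∈?_ _≟ₚ_ (a , b) L)) * φ (a , b))
  ∑≡∬ [] _ _ _ φ = sym (∬-zero rows cols (λ _ _ → refl))
  ∑≡∬ (q ∷ L) (q∉ ∷ L!) row∈ col∈ φ = begin
    φ q + ∑ L φ
      ≡⟨ cong₂ _+_ (sym (∬-δ (row∈ (here refl)) (col∈ (here refl)) φ))
                   (∑≡∬ L L! (row∈ ∘ there) (col∈ ∘ there) φ) ⟩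
    ∬ rows cols (λ a b → ind (does ((a , b) ≟ₚ q)) * φ (a , b))
      + ∬ rows cols (λ a b → ind (does (_∈?_ _≟ₚ_ (a , b) L)) * φ (a , b))
      ≡⟨ ∬-+ rows cols _ _ ⟨
    ∬ rows cols (λ a b → ind (does ((a , b) ≟ₚ q)) * φ (a , b) + ind (does (_∈?_ _≟ₚ_ (a , b) L)) * φ (a , b))
      ≡⟨ ∬-cong rows cols (λ {a} {b} _ _ → trans (sym (*-distribʳ-+ (φ (a , b)) (ind (does ((a , b) ≟ₚ q))) _))
           (cong (_* φ (a , b)) (member (a , b)))) ⟩
    ∬ rows cols (λ a b → ind (does (_∈?_ _≟ₚ_ (a , b) (q ∷ L))) * φ (a , b)) ∎
    where
    open ≡-Reasoning
    member : ∀ p → ind (does (p ≟ₚ q)) + ind (does (_∈?_ _≟ₚ_ p L)) ≡ ind (does (_∈?_ _≟ₚ_ p (q ∷ L)))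
    member p with p ≟ₚ q | _∈?_ _≟ₚ_ p L
    ... | yes refl | yes p∈ = ⊥-elim (All.lookup q∉ p∈ refl)
    ... | yes refl | no  _  = refl
    ... | no  _    | yes _  = refl
    ... | no  _    | no  _  = refl

has : FinSet → ℤ → ℤ → Bool
has F a b = does (_∈?_ _≟ₚ_ (a , b) (elems F))

has⇒∈ : ∀ F {a b} → has F a b ≡ true → (a , b) ∈ elems F
has⇒∈ F = does-true (_∈?_ _≟ₚ_ _ (elems F))

¬has⇒∉ : ∀ F {a b} → has F a b ≡ false → (a , b) ∉ elems F
¬has⇒∉ F = does-false (_∈?_ _≟ₚ_ _ (elems F))

-- Exchanging (a , b) and (a′ , b′) for (a , b′) and (a′ , b) keeps all line sums, so unique
-- determination would put (a , b′) into F.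
uniquelyDetermined⇒switchingFree : ∀ F → UniquelyDetermined F → SwitchingFree (has F)
uniquelyDetermined⇒switchingFree F unique {a} {a′} {b} {b′} ab a′b′ ab′ a′b
  with ys , F↭ ← ∈⇒↭ (has⇒∈ F ab) with ∈-resp-↭ F↭ (has⇒∈ F a′b′)
-- The two points coincide, so (a , b′) is (a , b).
... | here refl = ¬has⇒∉ F ab′ (has⇒∈ F ab)
... | there q∈ with L , ys↭ ← ∈⇒↭ q∈ =
  ¬has⇒∉ F ab′ (Equivalence.to (unique G rows≡ cols≡ (a , b′)) (here refl))
  where
  F↭′ : elems F ↭ (a , b) ∷ (a′ , b′) ∷ L
  F↭′ = ↭-trans F↭ (prep (a , b) ys↭)
  ∈L⇒∈F : ∀ {q} → q ∈ L → q ∈ elems F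
  ∈L⇒∈F q∈L = ∈-resp-↭ (↭-sym F↭′) (there (there q∈L))
  L! : Unique L
  L! with _ ∷ _ ∷ u ← Permₛ.Unique-resp-↭ (setoid Point) (↭⇒↭ₛ F↭′) (nodup F) = u
  G : FinSet
  G = finset ((a , b′) ∷ (a′ , b) ∷ L)
    (((λ { refl → ¬has⇒∉ F ab′ (has⇒∈ F a′b′) }) ∷ ¬Any⇒All¬ L (¬has⇒∉ F ab′ ∘ ∈L⇒∈F))
      ∷ ¬Any⇒All¬ L (¬has⇒∉ F a′b ∘ ∈L⇒∈F) ∷ L!)
  -- The exchanged points list their rows in the same order a, a′, so the row counts agree
  -- definitionally; for columns the first two summands have to be swapped.
  rows≡ : ∀ i → rowSum G i ≡ rowSum F i
  rows≡ i = trans (length-filter≡∑ (λ q → proj₁ q ℤ.≟ i) (elems G))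
    (sym (trans (length-filter≡∑ (λ q → proj₁ q ℤ.≟ i) (elems F)) (∑-↭ _ F↭′)))
  cols≡ : ∀ j → colSum G j ≡ colSum F j
  cols≡ j = trans (length-filter≡∑ (λ q → proj₂ q ℤ.≟ j) (elems G))
    (trans (x+[y+z]≡y+[x+z] (ind (does (b′ ℤ.≟ j))) (ind (does (b ℤ.≟ j))) _)
    (sym (trans (length-filter≡∑ (λ q → proj₂ q ℤ.≟ j) (elems F)) (∑-↭ _ F↭′))))

module _ (F : FinSet) {rows cols : List ℤ} (rows! : Unique rows) (cols! : Unique cols)
  (row∈ : ∀ {q} → q ∈ elems F → proj₁ q ∈ rows) (col∈ : ∀ {q} → q ∈ elems F → proj₂ q ∈ cols) where
  private
    X : ℤ → ℤ → ℕ
    X a b = ind (has F a b)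

  count≡∬ : ∀ {P : Pred Point 0ℓ} (P? : Decidable P) → length (filter P? (elems F)) ≡
    ∬ rows cols (λ a b → ind (has F a b) * ind (does (P? (a , b))))
  count≡∬ P? = trans (length-filter≡∑ P? (elems F)) (∑≡∬ rows! cols! (elems F) (nodup F) row∈ col∈ _)

  card≡∬ : card F ≡ ∬ rows cols X
  card≡∬ = begin
    length (elems F)                        ≡⟨ *-identityʳ _ ⟨
    length (elems F) * 1                    ≡⟨ ∑-const (elems F) 1 ⟨
    ∑ (elems F) (λ _ → 1)                   ≡⟨ ∑≡∬ rows! cols! (elems F) (nodup F) row∈ col∈ _ ⟩
    ∬ rows cols (λ a b → X a b * 1)         ≡⟨ ∬-cong rows cols (λ {a} {b} _ _ → *-identityʳ (X a b)) ⟩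
    ∬ rows cols X                           ∎
    where open ≡-Reasoning

  rowSum≡∑ : ∀ {i} → i ∈ rows → rowSum F i ≡ ∑ cols (X i)
  rowSum≡∑ {i} i∈ = begin
    rowSum F i                                             ≡⟨ count≡∬ (λ q → proj₁ q ℤ.≟ i) ⟩
    ∬ rows cols (λ a b → X a b * ind (does (a ℤ.≟ i)))     ≡⟨ ∑-cong rows (λ {a} _ → ∑-*ʳ cols (X a) _) ⟩
    ∑ rows (λ a → ind (does (a ℤ.≟ i)) * ∑ cols (X a))     ≡⟨ ∑-δ rows! i∈ (λ a → ∑ cols (X a)) ⟩
    ∑ cols (X i)                                           ∎
    where open ≡-Reasoning

  colSum≡∑ : ∀ {j} → j ∈ cols → colSum F j ≡ ∑ rows (λ a → X a j)
  colSum≡∑ {j} j∈ = begin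
    colSum F j                                             ≡⟨ count≡∬ (λ q → proj₂ q ℤ.≟ j) ⟩
    ∬ rows cols (λ a b → X a b * ind (does (b ℤ.≟ j)))     ≡⟨ ∑-swap rows cols _ ⟩
    ∑ cols (λ b → ∑ rows (λ a → X a b * ind (does (b ℤ.≟ j)))) ≡⟨ ∑-cong cols (λ {b} _ → ∑-*ʳ rows (λ a → X a b) _) ⟩
    ∑ cols (λ b → ind (does (b ℤ.≟ j)) * ∑ rows (λ a → X a b)) ≡⟨ ∑-δ cols! j∈ (λ b → ∑ rows (λ a → X a b)) ⟩
    ∑ rows (λ a → X a j)                                   ∎
    where open ≡-Reasoning

theorem12 : (F₁ F₂ : FinSet) → UniquelyDetermined F₁ → card F₁ ≡ card F₂ →
    (α : ℕ) → 2 * α ≡ totalError F₁ F₂ →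
    BoundHolds α (interCard F₁ F₂) (ℕtoℚ (card F₁) ℚ.- ℕtoℚ (interCard F₁ F₂))
theorem12 F₁ F₂ unique card≡ α 2α≡ =
  -- The rational difference is replaced by the natural number d, the number of points of F₁ outside
  -- F₂ counted on the grid of used rows and columns.
  subst (BoundHolds α p) (sym (trans (cong (λ x → ℕtoℚ x ℚ.- ℕtoℚ p) card₁≡p+d) (ℕtoℚ-∸ p d)))
    (d²≤α[α+1][p+d]⇒BoundHolds α p d
      (subst (λ s → d * d ≤ α * (α + 1) * s) (trans (sym card₁) card₁≡p+d)
        (matrix-bound f g (uniquelyDetermined⇒switchingFree F₁ unique) rows cols
          (trans (sym card₁) (trans card≡ card₂)) α (trans 2α≡ (cong₂ _+_ cols-error rows-error)))))
  where
  f g : ℤ → ℤ → Bool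
  f = has F₁
  g = has F₂
  rows cols : List ℤ
  rows = usedRows F₁ F₂
  cols = usedCols F₁ F₂
  p d : ℕ
  p = interCard F₁ F₂
  d = ∬ rows cols (λ a b → ind (f a b ∧ not (g a b)))
  rows! : Unique rows
  rows! = deduplicate-! ℤ._≟_ _
  cols! : Unique cols
  cols! = deduplicate-! ℤ._≟_ _
  row∈ : ∀ {q} → q ∈ elems F₁ ++ elems F₂ → proj₁ q ∈ rows
  row∈ q∈ = ∈-deduplicate⁺ ℤ._≟_ (∈-map⁺ proj₁ q∈)
  col∈ : ∀ {q} → q ∈ elems F₁ ++ elems F₂ → proj₂ q ∈ cols
  col∈ q∈ = ∈-deduplicate⁺ ℤ._≟_ (∈-map⁺ proj₂ q∈)
  inl : ∀ {q} → q ∈ elems F₁ → q ∈ elems F₁ ++ elems F₂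
  inl = ∈-++⁺ˡ
  inr : ∀ {q} → q ∈ elems F₂ → q ∈ elems F₁ ++ elems F₂
  inr = ∈-++⁺ʳ (elems F₁)
  card₁ : card F₁ ≡ ∬ rows cols (λ a b → ind (f a b))
  card₁ = card≡∬ F₁ rows! cols! (row∈ ∘ inl) (col∈ ∘ inl)
  card₂ : card F₂ ≡ ∬ rows cols (λ a b → ind (g a b))
  card₂ = card≡∬ F₂ rows! cols! (row∈ ∘ inr) (col∈ ∘ inr)
  card₁≡p+d : card F₁ ≡ p + d
  card₁≡p+d = trans card₁ (trans (∬-cong rows cols (λ {a} {b} _ _ → split (f a b) (g a b)))
    (trans (∬-+ rows cols _ _) (cong (_+ d)
      (sym (count≡∬ F₁ rows! cols! (row∈ ∘ inl) (col∈ ∘ inl) (λ q → _∈?_ _≟ₚ_ q (elems F₂)))))))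
    where
    split : ∀ x y → ind x ≡ ind x * ind y + ind (x ∧ not y)
    split true  true  = refl
    split true  false = refl
    split false y     = refl
  cols-error : ∑ cols (λ j → absDiff (colSum F₁ j) (colSum F₂ j)) ≡
    ∑ cols (λ j → absDiff (∑ rows (λ a → ind (f a j))) (∑ rows (λ a → ind (g a j))))
  cols-error = ∑-cong cols (λ j∈ → cong₂ absDiff
    (colSum≡∑ F₁ rows! cols! (row∈ ∘ inl) (col∈ ∘ inl) j∈) (colSum≡∑ F₂ rows! cols! (row∈ ∘ inr) (col∈ ∘ inr) j∈))
  rows-error : ∑ rows (λ i → absDiff (rowSum F₁ i) (rowSum F₂ i)) ≡
    ∑ rows (λ i → absDiff (∑ cols (λ b → ind (f i b))) (∑ cols (λ b → ind (g i b))))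
  rows-error = ∑-cong rows (λ i∈ → cong₂ absDiff
    (rowSum≡∑ F₁ rows! cols! (row∈ ∘ inl) (col∈ ∘ inl) i∈) (rowSum≡∑ F₂ rows! cols! (row∈ ∘ inr) (col∈ ∘ inr) i∈))
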